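{- Every oriented graph whose missing edges can be partitioned into a (possibly empty) matching and a (possibly empty) star contains a vertex with a large second neighborhood.
   Context: All graphs are finite and simple, with nonempty vertex set. An oriented graph is a digraph without loops or digons. For an oriented graph $D$, $N_D^+(v)$ and $N_D^-(v)$ are the out- and in-neighborhoods of $v$; $N_D^{++}(v)=\{u\in V(D)\setminus(\{v\}\cup N_D^+(v)) : N_D^-(u)\cap N_D^+(v)\neq\emptyset\}$. A vertex $v$ has a large second neighborhood if $|N_D^{++}(v)|\ge |N_D^+(v)|$. A missing edge of $D$ is an unordered pair of distinct vertices with no arc between them. A matching is a set of pairwise disjoint pairs; a star is a set of pairs all containing a common vertex (its center). -}

module Defs where

open import Data.Fin.Base using (Fin)
open import Data.Fin.Subset
  using (Subset; _∈_; _∉_; ⁅_⁆; _∪_; _∩_; ∣_∣; Nonempty; Empty)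
open import Data.Fin.Subset.Properties using (_∈?_; nonempty?)
open import Data.Nat.Base using (ℕ; _≥_)
open import Data.Product.Base using (_×_; ∃; ∃₂)
open import Data.Vec.Base using (tabulate)
open import Level using (0ℓ)
open import Relation.Binary.Core using (Rel)
open import Relation.Binary.Definitions using (Decidable)
open import Relation.Binary.PropositionalEquality.Core using (_≡_; _≢_)
open import Relation.Nullary.Decidable using (does; ¬?; _×-dec_)
open import Relation.Nullary.Negation using (¬_)
import Relation.Unary as U

record OrientedGraph (n : ℕ) : Set₁ where
  field
    Arc      : Rel (Fin n) 0ℓ
    arc?     : Decidable Arc
    noLoops  : ∀ {u} → ¬ Arc u u
    noDigons : ∀ {u v} → Arc u v → ¬ Arc v u

-- { u | P u }
comprehension : ∀ {n} {P : Fin n → Set} → U.Decidable P → Subset n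
comprehension P? = tabulate λ u → does (P? u)

module _ {n : ℕ} (D : OrientedGraph n) where
  open OrientedGraph D

  N⁺ : Fin n → Subset n
  N⁺ v = comprehension λ u → arc? v u

  N⁻ : Fin n → Subset n
  N⁻ v = comprehension λ u → arc? u v

  N⁺⁺ : Fin n → Subset n
  N⁺⁺ v = comprehension {P = λ u → u ∉ ⁅ v ⁆ ∪ N⁺ v × Nonempty (N⁻ u ∩ N⁺ v)}
    λ u → ¬? (u ∈? ⁅ v ⁆ ∪ N⁺ v) ×-dec nonempty? (N⁻ u ∩ N⁺ v)

  HasLargeSecondNeighborhood : Fin n → Set
  HasLargeSecondNeighborhood v = ∣ N⁺⁺ v ∣ ≥ ∣ N⁺ v ∣

-- An unordered pair of distinct vertices is a two-element subset, so that
-- propositional equality of pairs does not depend on the order.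
IsPair : ∀ {n} → U.Pred (Subset n) 0ℓ
IsPair e = ∃₂ λ u v → u ≢ v × e ≡ ⁅ u ⁆ ∪ ⁅ v ⁆

MissingEdge : ∀ {n} → OrientedGraph n → U.Pred (Subset n) 0ℓ
MissingEdge D e =
  ∃₂ λ u v → u ≢ v × e ≡ ⁅ u ⁆ ∪ ⁅ v ⁆ × ¬ Arc u v × ¬ Arc v u
  where open OrientedGraph D

IsMatching : ∀ {n} → U.Pred (Subset n) 0ℓ → Set
IsMatching M =
  M U.⊆ IsPair × (∀ {e f} → M e → M f → e ≢ f → Empty (e ∩ f))

IsStar : ∀ {n} → U.Pred (Subset n) 0ℓ → Set
IsStar S = S U.⊆ IsPair × ∃ λ c → ∀ {e} → S e → c ∈ e

-- For a decidable P (such as MissingEdge D) this makes A and B decidable too.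
_PartitionedInto_And_ : ∀ {n} (P A B : U.Pred (Subset n) 0ℓ) → Set
P PartitionedInto A And B = P U.≐ (A U.∪ B) × A U.⊥ B

{-# OPTIONS --safe #-}
module Submission where

-- If the centre z of the star is a sink, it has a large second neighborhood.
-- Otherwise fix an arc z → y and replace the arcs at z so that z dominates only
-- y and every other vertex dominates z. The missing edges then form a matching,
-- and a vertex f ≢ z whose second neighborhood is large even when z is not
-- counted in it also has a large second neighborhood in D.
--
-- Order the missing edges by Fidler and Yuster's "loses to" relation. A cycle
-- of this relation spans a homogeneous set K in which every vertex has as many
-- second out-neighbors as out-neighbors. Making K transitive leaves K without
-- inner second neighbors, so a large vertex of the new graph is large in the
-- old one, and there are fewer missing edges. Without cycles the relation
-- consists of paths; the missing edges are oriented consistently along them,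
-- and the last vertex f of a local median order of the vertices other than z is
-- large (Havet and Thomassé). Breaking ties between median orders in favour of
-- a late position of y gains the one vertex that compensates for an arc f → z.

open import Defs
open import Data.Bool.Base using (Bool; true; false; if_then_else_; not)
import Data.Bool.Properties as Bool
open import Data.Fin.Base as Fin using (Fin; zero; suc; toℕ; fromℕ<)
open import Data.Fin.Properties using (_≟_; any?; all?; ¬∀⟶∃¬; pigeonhole; toℕ<n; toℕ-fromℕ<)
import Data.Fin.Properties as Fin
open import Data.Fin.Subset using (Subset; ∣_∣; Nonempty; _∈_; _∉_; ⁅_⁆; _∪_; _∩_)
open import Data.Fin.Subset.Properties
  using (_∈?_; nonempty?; x∈⁅x⁆; x∈⁅y⁆⇒x≡y; x∈p∪q⁺; x∈p∪q⁻; x∈p∩q⁺;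
         x∈p∧x≢y⇒x∈p-y; x∈p⇒∣p-x∣<∣p∣; p⊂q⇒∣p∣<∣q∣)
open import Data.List.Base using (List; []; _∷_; _++_; map; length; filter; allFin; tabulate)
open import Data.List.Membership.Propositional renaming (_∈_ to _∈ₗ_) using ()
open import Data.List.Membership.Propositional.Properties using (∈-∃++; ∈-allFin; ∈-++⁺ˡ)
open import Data.List.Properties using (map-++; map-tabulate; length-++; length-map; length-tabulate)
open import Data.List.Relation.Binary.Permutation.Propositional
  using (_↭_; ↭-refl; ↭-sym; ↭-trans; ↭-reflexive; prep; ↭⇒↭ₛ)
import Data.List.Relation.Binary.Permutation.Propositional.Properties as Perm
import Data.List.Relation.Binary.Permutation.Setoid.Properties as Permₛ
open import Data.List.Relation.Unary.All as All using (All; []; _∷_)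
import Data.List.Relation.Unary.All.Properties as All
open import Data.List.Relation.Unary.AllPairs using ([]; _∷_)
open import Data.List.Relation.Unary.Any using (here; there)
open import Data.List.Relation.Unary.Unique.Propositional using (Unique)
import Data.List.Relation.Unary.Unique.Propositional.Properties as Unique
open import Data.Nat.Base hiding (pred)
open import Data.Nat.DivMod using (_/_; _%_; m≡m%n+[m/n]*n; m%n<n)
open import Data.Nat.GeneralisedArithmetic using (fold; fold-+)
open import Data.Nat.ListAction using (sum)
open import Data.Nat.ListAction.Properties using (sum-++; sum-↭)
open import Data.Nat.Properties hiding (_≟_)
open import Data.Nat.Tactic.RingSolver using (solve-∀)
open import Data.Product.Base using (_×_; _,_; ∃; ∃₂; proj₁; proj₂)
open import Data.Sum.Base using (_⊎_; inj₁; inj₂; [_,_]′)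
open import Data.Vec.Properties using (lookup∘tabulate; lookup⇒[]=; []=⇒lookup)
open import Function.Base using (_∘_; id; const)
open import Level using (0ℓ)
open import Relation.Binary.Core using (Rel)
open import Relation.Binary.Definitions using (Decidable; tri<; tri≈; tri>)
open import Relation.Binary.PropositionalEquality
open import Relation.Nullary.Decidable
  using (Dec; yes; no; does; ¬?; _×-dec_; _⊎-dec_; dec-true; dec-false; toSum)
open import Relation.Nullary.Negation using (¬_; contradiction)
open import Relation.Unary using (Pred)
import Relation.Unary as U

private
  variable
    n : ℕ
    A P Q R : Set

-- Counting

𝟙 : Dec P → ℕ
𝟙 p? = if does p? then 1 else 0

𝟙≤1 : (p? : Dec P) → 𝟙 p? ≤ 1
𝟙≤1 (yes _) = ≤-refl
𝟙≤1 (no _) = z≤n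

𝟙-true : (p? : Dec P) → P → 𝟙 p? ≡ 1
𝟙-true (yes _) _ = refl
𝟙-true (no ¬p) p = contradiction p ¬p

𝟙-false : (p? : Dec P) → ¬ P → 𝟙 p? ≡ 0
𝟙-false (yes p) ¬p = contradiction p ¬p
𝟙-false (no _) _ = refl

𝟙-mono : (p? : Dec P) (q? : Dec Q) → (P → Q) → 𝟙 p? ≤ 𝟙 q?
𝟙-mono (no _) _ _ = z≤n
𝟙-mono (yes p) q? f = ≤-reflexive (sym (𝟙-true q? (f p)))

𝟙-cover : (p? : Dec P) (q? : Dec Q) (r? : Dec R) → (P → Q ⊎ R) → 𝟙 p? ≤ 𝟙 q? + 𝟙 r?
𝟙-cover (no _) _ _ _ = z≤n
𝟙-cover (yes p) (yes _) _ _ = s≤s z≤n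
𝟙-cover (yes p) (no ¬q) (yes _) _ = ≤-refl
𝟙-cover (yes p) (no ¬q) (no ¬r) f = contradiction (f p) [ ¬q , ¬r ]′

𝟙-pack : (p? : Dec P) (q? : Dec Q) (r? : Dec R) →
         (Q → P) → (R → P) → (Q → ¬ R) → 𝟙 q? + 𝟙 r? ≤ 𝟙 p?
𝟙-pack p? (no _) r? _ g _ = 𝟙-mono r? p? g
𝟙-pack p? (yes q) (yes r) _ _ h = contradiction r (h q)
𝟙-pack p? (yes q) (no _) f _ _ = 𝟙-mono (yes q) p? f

∑ : List A → (A → ℕ) → ℕ
∑ xs f = sum (map f xs)

∑-++ : (f : A → ℕ) (xs ys : List A) → ∑ (xs ++ ys) f ≡ ∑ xs f + ∑ ys f
∑-++ f xs ys = trans (cong sum (map-++ f xs ys)) (sum-++ (map f xs) (map f ys))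

∑-↭ : (f : A → ℕ) {xs ys : List A} → xs ↭ ys → ∑ xs f ≡ ∑ ys f
∑-↭ f xs↭ys = sum-↭ (Perm.map⁺ f xs↭ys)

∑-mono : {f g : A → ℕ} (xs : List A) → (∀ {x} → x ∈ₗ xs → f x ≤ g x) → ∑ xs f ≤ ∑ xs g
∑-mono [] _ = z≤n
∑-mono (x ∷ xs) f≤g = +-mono-≤ (f≤g (here refl)) (∑-mono xs (f≤g ∘ there))

∑-+ : (f g : A → ℕ) (xs : List A) → ∑ xs (λ x → f x + g x) ≡ ∑ xs f + ∑ xs g
∑-+ f g [] = refl
∑-+ f g (x ∷ xs) rewrite ∑-+ f g xs = interchange (f x) (g x) (∑ xs f) (∑ xs g)
  where
  interchange : ∀ a b c d → (a + b) + (c + d) ≡ (a + c) + (b + d)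
  interchange = solve-∀

∑-* : (m : ℕ) (f : A → ℕ) (xs : List A) → ∑ xs (λ x → m * f x) ≡ m * ∑ xs f
∑-* m f [] = sym (*-zeroʳ m)
∑-* m f (x ∷ xs) rewrite ∑-* m f xs = sym (*-distribˡ-+ m (f x) (∑ xs f))

∑-const : (m : ℕ) (xs : List A) → ∑ xs (const m) ≡ length xs * m
∑-const m [] = refl
∑-const m (x ∷ xs) = cong (m +_) (∑-const m xs)

∑-𝟙-∉ : {P : A → Set} (P? : U.Decidable P) (xs : List A) →
        (∀ {x} → x ∈ₗ xs → ¬ P x) → ∑ xs (𝟙 ∘ P?) ≡ 0
∑-𝟙-∉ P? [] _ = refl
∑-𝟙-∉ P? (x ∷ xs) ∉P rewrite 𝟙-false (P? x) (∉P (here refl)) = ∑-𝟙-∉ P? xs (∉P ∘ there)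

∑-𝟙-≤1 : {P : A → Set} (P? : U.Decidable P) {xs : List A} →
         (∀ {x y} → P x → P y → x ≡ y) → Unique xs → ∑ xs (𝟙 ∘ P?) ≤ 1
∑-𝟙-≤1 P? {[]} _ _ = z≤n
∑-𝟙-≤1 P? {x ∷ xs} P-prop (x∉xs ∷ uxs) with P? x
... | no _ = ∑-𝟙-≤1 P? P-prop uxs
... | yes px = ≤-reflexive (cong suc (∑-𝟙-∉ P? xs λ y∈xs py → All.lookup x∉xs y∈xs (P-prop px py)))

1≤∑-𝟙 : {P : A → Set} (P? : U.Decidable P) {xs : List A} {x : A} →
        x ∈ₗ xs → P x → 1 ≤ ∑ xs (𝟙 ∘ P?)
1≤∑-𝟙 P? {x ∷ xs} (here refl) px rewrite 𝟙-true (P? x) px = s≤s z≤n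
1≤∑-𝟙 P? (there x∈xs) px = ≤-trans (1≤∑-𝟙 P? x∈xs px) (m≤n+m _ _)

comprehension⁺ : {P : Fin n → Set} (P? : U.Decidable P) {u : Fin n} →
                 P u → u ∈ comprehension P?
comprehension⁺ P? {u} pu = lookup⇒[]= u _ (trans (lookup∘tabulate _ u) (dec-true (P? u) pu))

comprehension⁻ : {P : Fin n → Set} (P? : U.Decidable P) {u : Fin n} →
                 u ∈ comprehension P? → P u
comprehension⁻ P? {u} u∈P with P? u | trans (sym (lookup∘tabulate (does ∘ P?) u)) ([]=⇒lookup u∈P)
... | yes pu | _ = pu
... | no _ | ()

# : {P : Fin n → Set} → U.Decidable P → ℕ
# P? = ∣ comprehension P? ∣

#-∑ : {P : Fin n → Set} (P? : U.Decidable P) → # P? ≡ ∑ (allFin n) (𝟙 ∘ P?)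
#-∑ P? = trans (go P?) (cong sum (sym (map-tabulate id (𝟙 ∘ P?))))
  where
  go : {P : Fin n → Set} (P? : U.Decidable P) → # P? ≡ sum (tabulate (𝟙 ∘ P?))
  go {n = zero} P? = refl
  go {n = suc n} P? with does (P? zero)
  ... | true = cong suc (go (P? ∘ suc))
  ... | false = go (P? ∘ suc)

length≤∣∣ : {p : Subset n} {xs : List (Fin n)} → Unique xs → All (_∈ p) xs → length xs ≤ ∣ p ∣
length≤∣∣ [] [] = z≤n
length≤∣∣ {p = p} (x∉xs ∷ uxs) (x∈p ∷ xs⊆p) =
  ≤-trans (s≤s (length≤∣∣ uxs (All.zipWith (λ (x≢y , y∈p) → x∈p∧x≢y⇒x∈p-y y∈p (≢-sym x≢y)) (x∉xs , xs⊆p))))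
          (x∈p⇒∣p-x∣<∣p∣ x∈p)

length-filter : {P : A → Set} (P? : U.Decidable P) (xs : List A) → length (filter P? xs) ≡ ∑ xs (𝟙 ∘ P?)
length-filter P? [] = refl
length-filter P? (x ∷ xs) with does (P? x)
... | true = cong suc (length-filter P? xs)
... | false = length-filter P? xs

module _ {P Q : Fin n → Set} (P? : U.Decidable P) (Q? : U.Decidable Q) where

  #-mono : (∀ {u} → P u → Q u) → # P? ≤ # Q?
  #-mono P⊆Q = subst₂ _≤_ (sym (#-∑ P?)) (sym (#-∑ Q?))
    (∑-mono (allFin n) λ {u} _ → 𝟙-mono (P? u) (Q? u) P⊆Q)

  module _ {R : Fin n → Set} (R? : U.Decidable R) where

    #-cover : (∀ {u} → P u → Q u ⊎ R u) → # P? ≤ # Q? + # R?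
    #-cover P⊆Q∪R = begin
      # P?                                             ≡⟨ #-∑ P? ⟩
      ∑ (allFin n) (𝟙 ∘ P?)                            ≤⟨ ∑-mono (allFin n) (λ {u} _ → 𝟙-cover (P? u) (Q? u) (R? u) P⊆Q∪R) ⟩
      ∑ (allFin n) (λ u → 𝟙 (Q? u) + 𝟙 (R? u))         ≡⟨ ∑-+ (𝟙 ∘ Q?) (𝟙 ∘ R?) (allFin n) ⟩
      ∑ (allFin n) (𝟙 ∘ Q?) + ∑ (allFin n) (𝟙 ∘ R?)    ≡⟨ cong₂ _+_ (#-∑ Q?) (#-∑ R?) ⟨
      # Q? + # R?                                      ∎
      where open ≤-Reasoning

    #-pack : (∀ {u} → Q u → P u) → (∀ {u} → R u → P u) → (∀ {u} → Q u → ¬ R u) → # Q? + # R? ≤ # P?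
    #-pack Q⊆P R⊆P disjoint = begin
      # Q? + # R?                                      ≡⟨ cong₂ _+_ (#-∑ Q?) (#-∑ R?) ⟩
      ∑ (allFin n) (𝟙 ∘ Q?) + ∑ (allFin n) (𝟙 ∘ R?)    ≡⟨ ∑-+ (𝟙 ∘ Q?) (𝟙 ∘ R?) (allFin n) ⟨
      ∑ (allFin n) (λ u → 𝟙 (Q? u) + 𝟙 (R? u))         ≤⟨ ∑-mono (allFin n) (λ {u} _ → 𝟙-pack (P? u) (Q? u) (R? u) Q⊆P R⊆P disjoint) ⟩
      ∑ (allFin n) (𝟙 ∘ P?)                            ≡⟨ #-∑ P? ⟨
      # P?                                             ∎
      where open ≤-Reasoning

-- Local median orders

DominatesPrefixes : (f g : A → ℕ) → List A → Set
DominatesPrefixes f g xs = ∀ S R → xs ≡ S ++ R → ∑ S g ≤ ∑ S f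

-- On failure the offending prefix is returned, since `improve` moves a vertex past it.
dominatesPrefixes? : (f g : A → ℕ) (xs : List A) →
  DominatesPrefixes f g xs ⊎ ∃₂ λ S R → xs ≡ S ++ R × ∑ S f < ∑ S g
dominatesPrefixes? {A = A} f g = go 0 0
  where
  go : ∀ i j (xs : List A) →
       (∀ S R → xs ≡ S ++ R → j + ∑ S g ≤ i + ∑ S f) ⊎
       ∃₂ λ S R → xs ≡ S ++ R × i + ∑ S f < j + ∑ S g
  go i j xs with j ≤? i
  ... | no j≰i = inj₂ ([] , xs , refl , subst₂ _<_ (sym (+-identityʳ i)) (sym (+-identityʳ j)) (≰⇒> j≰i))
  go i j [] | yes j≤i = inj₁ λ { [] _ _ → +-monoˡ-≤ 0 j≤i }
  go i j (x ∷ xs) | yes j≤i with go (i + f x) (j + g x) xs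
  ... | inj₁ ok = inj₁ λ where
    [] _ _ → +-monoˡ-≤ 0 j≤i
    (_ ∷ S) R refl → subst₂ _≤_ (+-assoc j _ _) (+-assoc i _ _) (ok S R refl)
  ... | inj₂ (S , R , refl , bad) =
    inj₂ (x ∷ S , R , refl , subst₂ _<_ (+-assoc i _ _) (+-assoc j _ _) bad)

-- Orders are listed backwards: the head is the last vertex of the order, and
-- what follows a vertex in the list precedes it in the order.
module _ (c : A → A → ℕ) where

  data LocallyMedian : List A → Set where
    [] : LocallyMedian []
    _∷_ : ∀ {b xs} → DominatesPrefixes (λ w → c w b) (c b) xs → LocallyMedian xs → LocallyMedian (b ∷ xs)

  -- The quantity that a median order maximizes: `c u v` is the reward for placing `u` before `v`.
  weight : List A → ℕ
  weight [] = 0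
  weight (b ∷ xs) = ∑ xs (λ w → c w b) + weight xs

  weight-insert : ∀ b S R →
    weight (S ++ b ∷ R) ≡ ∑ S (c b) + ∑ R (λ w → c w b) + weight (S ++ R)
  weight-insert b [] R = refl
  weight-insert b (x ∷ S) R
    rewrite weight-insert b S R | ∑-↭ (λ w → c w x) (Perm.shift b S R) =
    rearrange (c b x) _ (∑ S (c b)) _ _
    where
    rearrange : ∀ bx r s t u → (bx + r) + (s + t + u) ≡ (bx + s) + t + (r + u)
    rearrange = solve-∀

  -- If `S` violates the inequality for `b`, moving `b` past `S` reverses only the pairs between `b`
  -- and `S`, so the weight strictly rises.
  improve : ∀ xs → LocallyMedian xs ⊎ ∃ λ ys → ys ↭ xs × weight xs < weight ys
  improve [] = inj₁ []
  improve (b ∷ xs) with improve xs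
  ... | inj₂ (ys , ys↭xs , lt) = inj₂
    (b ∷ ys , prep b ys↭xs , +-mono-≤-< (≤-reflexive (sym (∑-↭ (λ w → c w b) ys↭xs))) lt)
  ... | inj₁ median with dominatesPrefixes? (λ w → c w b) (c b) xs
  ...   | inj₁ ok = inj₁ (ok ∷ median)
  ...   | inj₂ (S , R , refl , lt) = inj₂ (S ++ b ∷ R , Perm.shift b S R , (begin-strict
      ∑ (S ++ R) (λ w → c w b) + weight (S ++ R)                   ≡⟨ cong (_+ weight (S ++ R)) (∑-++ (λ w → c w b) S R) ⟩
      ∑ S (λ w → c w b) + ∑ R (λ w → c w b) + weight (S ++ R)      <⟨ +-monoˡ-< (weight (S ++ R)) (+-monoˡ-< _ lt) ⟩
      ∑ S (c b) + ∑ R (λ w → c w b) + weight (S ++ R)              ≡⟨ weight-insert b S R ⟨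
      weight (S ++ b ∷ R)                                          ∎))
      where open ≤-Reasoning

  module _ {m : ℕ} (c≤m : ∀ u v → c u v ≤ m) where

    weight-bound : ∀ xs → weight xs ≤ length xs * length xs * m
    weight-bound [] = z≤n
    weight-bound (b ∷ xs) = begin
      ∑ xs (λ w → c w b) + weight xs      ≤⟨ +-mono-≤ (∑-mono xs (λ _ → c≤m _ b)) (weight-bound xs) ⟩
      ∑ xs (const m) + l * l * m          ≡⟨ cong (_+ l * l * m) (∑-const m xs) ⟩
      l * m + l * l * m                   ≤⟨ m≤m+n _ _ ⟩
      (l * m + l * l * m) + (m + l * m)   ≡⟨ square l m ⟩
      suc l * suc l * m                   ∎
      where
      open ≤-Reasoning
      l = length xs
      square : ∀ l m → (l * m + l * l * m) + (m + l * m) ≡ suc l * suc l * m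
      square = solve-∀

    locallyMedian-exists : ∀ xs → ∃ λ ys → ys ↭ xs × LocallyMedian ys
    locallyMedian-exists xs = search (length xs * length xs * m) xs ↭-refl (m≤m+n _ _)
      where
      bound = length xs * length xs * m
      -- Each improvement raises the bounded weight by at least one, so the gap to `bound` serves as
      -- fuel.
      search : ∀ fuel ys → ys ↭ xs → bound ≤ fuel + weight ys → ∃ λ ys → ys ↭ xs × LocallyMedian ys
      search fuel ys ys↭xs enough with improve ys
      ... | inj₁ median = ys , ys↭xs , median
      search zero ys ys↭xs enough | inj₂ (zs , zs↭ys , lt) =
        contradiction (<-≤-trans (≤-<-trans enough lt)
          (subst (λ l → weight zs ≤ l * l * m) (Perm.↭-length (↭-trans zs↭ys ys↭xs)) (weight-bound zs)))
          (<-irrefl refl)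
      search (suc fuel) ys ys↭xs enough | inj₂ (zs , zs↭ys , lt) =
        search fuel zs (↭-trans zs↭ys ys↭xs)
          (≤-trans enough (≤-trans (≤-reflexive (sym (+-suc fuel (weight ys)))) (+-monoʳ-≤ fuel lt)))

-- A lexicographic comparison: `r < N` rules out `q < p`; for `p < q` the unit gap absorbs `e`; for
-- `p ≡ q` what remains is `e ≤ r`, and one of the two vanishes.
*-cancel-slack : ∀ N p e q r → N * p + e ≤ N * q + r →
                 e ≤ 1 → r < N → e ≡ 0 ⊎ r ≡ 0 → p + e ≤ q
*-cancel-slack N p e q r h e≤1 r<N e≡0⊎r≡0 with <-cmp p q
... | tri< p<q _ _ = ≤-trans (+-monoʳ-≤ p e≤1) (subst (_≤ q) (+-comm 1 p) p<q)
... | tri> _ _ q<p = contradiction (begin-strict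
  N * q + r    <⟨ +-monoʳ-< (N * q) r<N ⟩
  N * q + N    ≡⟨ trans (+-comm (N * q) N) (sym (*-suc N q)) ⟩
  N * suc q    ≤⟨ *-monoʳ-≤ N q<p ⟩
  N * p        ≤⟨ m≤m+n _ _ ⟩
  N * p + e    ≤⟨ h ⟩
  N * q + r    ∎) (<-irrefl refl)
  where open ≤-Reasoning
... | tri≈ _ refl _ = ≤-reflexive (trans (cong (p +_) (e≡0 e≡0⊎r≡0)) (+-identityʳ p))
  where
  e≡0 : e ≡ 0 ⊎ r ≡ 0 → e ≡ 0
  e≡0 (inj₁ eq) = eq
  e≡0 (inj₂ refl) = n≤0⇒n≡0 (+-cancelˡ-≤ (N * p) e 0 h)

-- With N large, an arc outweighs all the bonuses for a late position of y.
arcCost : {T : Rel (Fin n) 0ℓ} → Decidable T → ℕ → Fin n → Fin n → Fin n → ℕ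
arcCost T? N y u v = N * 𝟙 (T? u v) + 𝟙 (v ≟ y)

-- `O` and `Q` stand for the first and second out-neighborhoods of `f`. They are parameters because
-- `counted-forward` enlarges each by one vertex.
module Feed
  {T : Rel (Fin n) 0ℓ} {O Q : U.Pred (Fin n) 0ℓ} (T? : Decidable T) (O? : U.Decidable O) (Q? : U.Decidable Q)
  (T-asym : ∀ {u v} → T u v → ¬ T v u) (N : ℕ) (y f : Fin n) where

  cost : Fin n → Fin n → ℕ
  cost = arcCost T? N y

  Bad : Fin n → Set
  Bad w = ¬ O w × ¬ Q w

  module _
    (O⇒T : ∀ {w} → O w → T f w)
    (bad⇒T : ∀ {w x} → w ≢ f → Bad w → O x → T w x)
    (y-good : f ≢ y → O y ⊎ Q y) where

    -- The out-neighbors of `b` in `S` include those in `O`. By the balance at least as many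
    -- vertices of `S` dominate `b`, and by asymmetry these lie in `Q`. If `y` is in `S`, its bonus
    -- makes the comparison strict.
    segment : ∀ b S → Unique (b ∷ S) → length S < N →
              (∀ {x} → O x → T b x) → (∀ {w} → w ∈ₗ S → O w ⊎ Q w) →
              ∑ S (cost b) ≤ ∑ S (λ w → cost w b) →
              ∑ S (𝟙 ∘ O?) + ∑ S (λ w → 𝟙 (w ≟ y)) ≤ ∑ S (𝟙 ∘ Q?)
    segment b S (b∉S ∷ uS) len b→O good balance = begin
      ∑ S (𝟙 ∘ O?) + e
        ≤⟨ +-monoˡ-≤ e (∑-mono S λ {w} _ → 𝟙-mono (O? w) (T? b w) b→O) ⟩
      ∑ S (𝟙 ∘ T? b) + e
        ≤⟨ *-cancel-slack N _ e _ r balance′ (∑-𝟙-≤1 (_≟ y) (λ { refl refl → refl }) uS) r<N (e≡0⊎r≡0 (b ≟ y)) ⟩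
      ∑ S (λ w → 𝟙 (T? w b))
        ≤⟨ ∑-mono S (λ {w} w∈S → 𝟙-mono (T? w b) (Q? w) λ w→b →
             [ (λ o → contradiction w→b (T-asym (b→O o))) , id ]′ (good w∈S)) ⟩
      ∑ S (𝟙 ∘ Q?) ∎
      where
      open ≤-Reasoning
      -- `e` is the bonus for `b` before `y`, and `r` the bonus for the vertices of `S` before
      -- `b ≡ y`. Only one can be nonzero, as `b` is not in `S`.
      e = ∑ S (λ w → 𝟙 (w ≟ y))
      r = length S * 𝟙 (b ≟ y)
      balance′ : N * ∑ S (𝟙 ∘ T? b) + e ≤ N * ∑ S (λ w → 𝟙 (T? w b)) + r
      balance′ = subst₂ _≤_
        (trans (∑-+ _ _ S) (cong (_+ e) (∑-* N _ S)))
        (trans (∑-+ _ _ S) (cong₂ _+_ (∑-* N _ S) (∑-const _ S)))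
        balance
      r<N : r < N
      r<N = ≤-<-trans (≤-trans (*-monoʳ-≤ (length S) (𝟙≤1 (b ≟ y))) (≤-reflexive (*-identityʳ _))) len
      e≡0⊎r≡0 : Dec (b ≡ y) → e ≡ 0 ⊎ r ≡ 0
      e≡0⊎r≡0 (yes refl) = inj₁ (∑-𝟙-∉ (_≟ y) S λ { w∈S refl → All.lookup b∉S w∈S refl })
      e≡0⊎r≡0 (no b≢y) = inj₂ (trans (cong (length S *_) (𝟙-false (b ≟ y) b≢y)) (*-zeroʳ (length S)))

    Holds : List (Fin n) → Set
    Holds xs = ∑ xs (𝟙 ∘ O?) + ∑ xs (λ w → 𝟙 (w ≟ y)) ≤ ∑ xs (𝟙 ∘ Q?)

    holds-++ : ∀ xs {ys} → Holds xs → Holds ys → Holds (xs ++ ys)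
    holds-++ xs {ys} h h′
      rewrite ∑-++ (𝟙 ∘ O?) xs ys | ∑-++ (λ w → 𝟙 (w ≟ y)) xs ys | ∑-++ (𝟙 ∘ Q?) xs ys =
      subst (_≤ ∑ xs (𝟙 ∘ Q?) + ∑ ys (𝟙 ∘ Q?))
        (interchange (∑ xs (𝟙 ∘ O?)) (∑ xs (λ w → 𝟙 (w ≟ y))) (∑ ys (𝟙 ∘ O?)) (∑ ys (λ w → 𝟙 (w ≟ y))))
        (+-mono-≤ h h′)
      where
      interchange : ∀ a b c d → (a + b) + (c + d) ≡ (a + c) + (b + d)
      interchange = solve-∀

    close : ∀ b S R → Unique (b ∷ S ++ R) → length (b ∷ S ++ R) ≤ N →
            (∀ {x} → O x → T b x) → (∀ {w} → w ∈ₗ S → O w ⊎ Q w) →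
            DominatesPrefixes (λ w → cost w b) (cost b) (S ++ R) →
            Holds R → Holds (S ++ R)
    close b S R (b∉ ∷ u) len b→O good dom =
      holds-++ S {R} (segment b S (All.tabulate (All.lookup b∉ ∘ ∈-++⁺ˡ) ∷ unique-++⁻ˡ S u)
        (≤-trans (s≤s (≤-trans (m≤m+n _ _) (≤-reflexive (sym (length-++ S))))) len)
        b→O good (dom S R refl))
      where
      unique-++⁻ˡ : ∀ S {R : List (Fin n)} → Unique (S ++ R) → Unique S
      unique-++⁻ˡ [] _ = []
      unique-++⁻ˡ (x ∷ S) (x∉ ∷ u) = All.tabulate (All.lookup x∉ ∘ ∈-++⁺ˡ) ∷ unique-++⁻ˡ S u

    -- The order is cut at the bad vertices, and each piece is compared with the
    -- bad vertex that follows it.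
    decompose : ∀ xs → LocallyMedian cost xs → Unique (f ∷ xs) → length xs ≤ N →
      ∃₂ λ S R → xs ≡ S ++ R × (∀ {w} → w ∈ₗ S → O w ⊎ Q w) × Holds R
    decompose [] _ _ _ = [] , [] , refl , (λ ()) , z≤n
    decompose (w ∷ xs) (dom ∷ median) ((f≢w ∷ f∉xs) ∷ u@(_ ∷ uxs)) len
      with decompose xs median (f∉xs ∷ uxs) (<⇒≤ len)
    ... | S , R , refl , good , h with O? w ⊎-dec Q? w
    ...   | yes g = w ∷ S , R , refl , (λ { (here refl) → g ; (there w∈S) → good w∈S }) , h
    ...   | no ¬g = [] , w ∷ S ++ R , refl , (λ ()) ,
      holds-++ (w ∷ []) {S ++ R} single
        (close w S R u len (bad⇒T (≢-sym f≢w) (¬g ∘ inj₁ , ¬g ∘ inj₂)) good dom h)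
      where
      -- By `y-good` a bad vertex is not `y`, so it adds nothing to the left-hand side.
      single : Holds (w ∷ [])
      single rewrite 𝟙-false (O? w) (¬g ∘ inj₁)
                   | 𝟙-false (w ≟ y) (λ { refl → ¬g (y-good f≢w) }) = z≤n

    -- The piece left open by `decompose` is compared with `f`, which dominates `O` just as a bad
    -- vertex does.
    feed : ∀ xs → LocallyMedian cost (f ∷ xs) → Unique (f ∷ xs) → length (f ∷ xs) ≤ N → Holds xs
    feed xs (dom ∷ median) u len with decompose xs median u (<⇒≤ len)
    ... | S , R , refl , good , h = close f S R u len O⇒T good dom h

-- Missing edges forming a matching

module Adjacency (D : OrientedGraph n) where
  open OrientedGraph D

  Missing : Rel (Fin n) 0ℓ
  Missing u v = u ≢ v × ¬ Arc u v × ¬ Arc v u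

  missing? : Decidable Missing
  missing? u v = ¬? (u ≟ v) ×-dec ¬? (arc? u v) ×-dec ¬? (arc? v u)

  missing-sym : ∀ {u v} → Missing u v → Missing v u
  missing-sym (u≢v , ¬uv , ¬vu) = ≢-sym u≢v , ¬vu , ¬uv

  adjacent : ∀ {u v} → u ≢ v → ¬ Missing u v → Arc u v ⊎ Arc v u
  adjacent {u} {v} u≢v ¬miss with arc? u v | arc? v u
  ... | yes uv | _ = inj₁ uv
  ... | no _ | yes vu = inj₂ vu
  ... | no ¬uv | no ¬vu = contradiction (u≢v , ¬uv , ¬vu) ¬miss

  Reaches : Rel (Fin n) 0ℓ
  Reaches u v = Arc u v ⊎ ∃ λ w → Arc u w × Arc w v

  reaches? : Decidable Reaches
  reaches? u v = arc? u v ⊎-dec any? λ w → arc? u w ×-dec arc? w v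

  Second : Rel (Fin n) 0ℓ
  Second u v = v ≢ u × ¬ Arc u v × ∃ λ w → Arc u w × Arc w v

  second? : Decidable Second
  second? u v = ¬? (v ≟ u) ×-dec ¬? (arc? u v) ×-dec any? λ w → arc? u w ×-dec arc? w v

  ¬reaches : ∀ {u v} → v ≢ u → ¬ Arc u v → ¬ Second u v → ¬ Reaches u v
  ¬reaches v≢u ¬uv ¬2 (inj₁ uv) = ¬uv uv
  ¬reaches v≢u ¬uv ¬2 (inj₂ path) = ¬2 (v≢u , ¬uv , path)

  secondOff? : ∀ z u → U.Decidable (λ v → v ≢ z × Second u v)
  secondOff? z u v = ¬? (v ≟ z) ×-dec second? u v

  -- `z` is excluded on the right only: a path into `z` in the graph `apex` need not exist in the
  -- original graph.
  LargeOff : Fin n → Fin n → Set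
  LargeOff z v = # (arc? v) ≤ # (secondOff? z v)

module Matching (D : OrientedGraph n)
  (missing-unique : ∀ {a b c} → Adjacency.Missing D a b → Adjacency.Missing D a c → b ≡ c) where
  open OrientedGraph D
  open Adjacency D

  Witness : Fin n → Rel (Fin n) 0ℓ
  Witness v a b = Arc v a × ¬ Reaches v b

  witness? : ∀ v → Decidable (Witness v)
  witness? v a b = arc? v a ×-dec ¬? (reaches? v b)

  -- The missing edge {v, u} loses to {b, a} when v → a, u → b and neither v
  -- reaches b nor u reaches a in at most two steps. The relation is tracked on
  -- the endpoints v and b, for which b → v.
  Loses : Rel (Fin n) 0ℓ
  Loses v b = ∃₂ λ u a → Missing v u × Missing b a × Witness v a b × Witness u b a

  loses? : Decidable Loses
  loses? v b = any? λ u → any? λ a →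
    missing? v u ×-dec missing? b a ×-dec witness? v a b ×-dec witness? u b a

  witness-arc : ∀ {v a b} → Missing b a → Witness v a b → Arc b v
  witness-arc {v} {a} {b} miss@(_ , ¬ba , _) (va , ¬r) with adjacent {b} {v} (λ { refl → ¬ba va })
    (λ miss′ → noLoops (subst (Arc v) (missing-unique miss miss′) va))
  ... | inj₁ bv = bv
  ... | inj₂ vb = contradiction (inj₁ vb) ¬r

  -- An arc between `v` and `u` would continue to a two-step path that one of the witnesses
  -- excludes.
  witnesses-missing : ∀ {u v a b} → Witness v a b → Witness u b a → Missing v u
  witnesses-missing (va , ¬vb) (ub , ¬ua) =
    (λ { refl → ¬ua (inj₁ va) }) , (λ vu → ¬vb (inj₂ (_ , vu , ub))) , λ uv → ¬ua (inj₂ (_ , uv , va))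

  loses-partner : ∀ {v b u a} → Missing v u → Missing b a → Loses v b → Loses u a
  loses-partner vu ba (u , a , vu′ , ba′ , w , w′)
    with refl ← missing-unique vu vu′ | refl ← missing-unique ba ba′ =
    _ , _ , missing-sym vu , missing-sym ba , w′ , w

  loses-arc : ∀ {v b} → Loses v b → Arc b v
  loses-arc (_ , _ , _ , ba , w , _) = witness-arc ba w

  -- `v` is a witness against one orientation of `{b, a}` and the partner of `v′` against the other,
  -- so these two form a missing pair.
  loses-injective : ∀ {v v′ b} → Loses v b → Loses v′ b → v ≡ v′
  loses-injective (u , a , vu , ba , w , w′) (u′ , a′ , v′u′ , ba′ , x , x′)
    with refl ← missing-unique ba ba′ =
    missing-unique (missing-sym (witnesses-missing w x′)) (missing-sym v′u′)

  -- An arc `a → x` would let `v` reach `x`, and `x → a` would let `u` reach `a`. So `x` is the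
  -- missing partner of `a`.
  loses-only : ∀ {v u b x} → Loses v b → Missing v u → Arc u x → ¬ Reaches v x → x ≡ b
  loses-only {x = x} (u , a , vu , ba , (va , ¬vb) , (ub , ¬ua)) vu′ ux ¬vx
    with refl ← missing-unique vu vu′
    with missing? a x
  ... | yes ax = missing-unique ax (missing-sym ba)
  ... | no ¬ax with adjacent {a} {x} (λ { refl → ¬vx (inj₁ va) }) ¬ax
  ...   | inj₁ ax = contradiction (inj₂ (_ , va , ax)) ¬vx
  ...   | inj₂ xa = contradiction (inj₂ (_ , ux , xa)) ¬ua

  loses-functional : ∀ {v b b′} → Loses v b → Loses v b′ → b ≡ b′
  loses-functional l (u , a , vu , ba , (va , ¬vb) , (ub , ¬ua)) = sym (loses-only l vu ub ¬vb)

  HasPred : Fin n → Set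
  HasPred b = ∃ λ v → Loses v b

  hasPred? : U.Decidable HasPred
  hasPred? b = any? λ v → loses? v b

  hasPred-partner : ∀ {a b} → Missing a b → HasPred a → HasPred b
  hasPred-partner ab (v , l@(u , _ , vu , _)) = u , loses-partner vu ab l

  abstract
    -- A vertex without predecessor is kept fixed, so that a walk along `pred` stops at a root.
    pred : Fin n → Fin n
    pred b with hasPred? b
    ... | yes (v , _) = v
    ... | no _ = b

    pred-loses : ∀ {b} → HasPred b → Loses (pred b) b
    pred-loses {b} h with hasPred? b
    ... | yes (_ , l) = l
    ... | no ¬h = contradiction h ¬h

    pred-root : ∀ {b} → ¬ HasPred b → pred b ≡ b
    pred-root {b} ¬h with hasPred? b
    ... | yes h = contradiction h ¬h
    ... | no _ = refl

  pred-unique : ∀ {v b} → Loses v b → pred b ≡ v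
  pred-unique l = loses-injective (pred-loses (_ , l)) l

  pred-partner : ∀ {a b} → Missing a b → HasPred a → Missing (pred a) (pred b)
  pred-partner ab h with u , _ , vu , _ ← pred-loses h =
    subst (Missing _) (sym (pred-unique (loses-partner vu ab (pred-loses h)))) vu

  -- Orienting the missing edge at b towards b would make b a second out-neighbor
  -- of some v that cannot reach b in D within two steps.
  Opposed : Fin n → Set
  Opposed b = ∃₂ λ a v → Missing b a × Witness v a b

  opposed? : U.Decidable Opposed
  opposed? b = any? λ a → any? λ v → missing? b a ×-dec witness? v a b

  -- The witnesses against the two orientations form a missing pair that loses to `{b, a}`. Hence at
  -- a root at most one orientation is opposed.
  opposed⇒hasPred : ∀ {a b} → Missing b a → Opposed b → Opposed a → HasPred b
  opposed⇒hasPred ba (a , v , ba′ , w) (b , u , ab , w′)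
    with refl ← missing-unique ba ba′ | refl ← missing-unique (missing-sym ba) ab =
    v , u , a , witnesses-missing w w′ , ba , w , w′

  -- The tie-break on indices applies when both or neither orientation is opposed.
  Beats : Rel (Fin n) 0ℓ
  Beats b a = (Opposed b × ¬ Opposed a) ⊎ ((Opposed b ⊎ ¬ Opposed a) × b Fin.< a)

  beats? : Decidable Beats
  beats? b a = (opposed? b ×-dec ¬? (opposed? a)) ⊎-dec ((opposed? b ⊎-dec ¬? (opposed? a)) ×-dec b Fin.<? a)

  beats-asym : ∀ {a b} → Beats a b → ¬ Beats b a
  beats-asym (inj₁ (oa , _)) (inj₁ (_ , ¬oa)) = ¬oa oa
  beats-asym (inj₁ (oa , ¬ob)) (inj₂ (inj₁ ob , _)) = ¬ob ob
  beats-asym (inj₁ (oa , ¬ob)) (inj₂ (inj₂ ¬oa , _)) = ¬oa oa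
  beats-asym (inj₂ (inj₁ oa , _)) (inj₁ (_ , ¬oa)) = ¬oa oa
  beats-asym (inj₂ (inj₂ ¬ob , _)) (inj₁ (ob , _)) = ¬ob ob
  beats-asym (inj₂ (_ , a<b)) (inj₂ (_ , b<a)) = Fin.<-asym a<b b<a

  beats-total : ∀ {a b} → a ≢ b → ¬ Beats a b → Beats b a
  beats-total {a} {b} a≢b ¬ab with opposed? a | opposed? b | Fin.<-cmp a b
  ... | yes oa | no ¬ob | _ = contradiction (inj₁ (oa , ¬ob)) ¬ab
  ... | no ¬oa | yes ob | _ = inj₁ (ob , ¬oa)
  ... | _ | _ | tri≈ _ a≡b _ = contradiction a≡b a≢b
  ... | yes oa | yes ob | tri< a<b _ _ = contradiction (inj₂ (inj₁ oa , a<b)) ¬ab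
  ... | no ¬oa | no ¬ob | tri< a<b _ _ = contradiction (inj₂ (inj₂ ¬ob , a<b)) ¬ab
  ... | yes oa | yes ob | tri> _ _ b<a = inj₂ (inj₁ ob , b<a)
  ... | no ¬oa | no ¬ob | tri> _ _ b<a = inj₂ (inj₂ ¬oa , b<a)

  Initial : Fin n → Set
  Initial b = ∃ λ a → Missing b a × Beats b a

  initial? : U.Decidable Initial
  initial? b = any? λ a → missing? b a ×-dec beats? b a

  initial-partner : ∀ {a b} → Missing a b → does (initial? a) ≡ not (does (initial? b))
  initial-partner {a} {b} ab with initial? b
  ... | yes (a′ , ba′ , b>a) = dec-false (initial? a) λ (b′ , ab′ , a>b) → beats-asym b>a
    (subst₂ Beats (missing-unique (missing-sym ab) ba′) (sym (missing-unique ab ab′)) a>b)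
  ... | no ¬i = dec-true (initial? a) (b , ab , beats-total (≢-sym (proj₁ ab)) λ b>a → ¬i (a , missing-sym ab , b>a))

  -- tail k b ≡ true orients the missing edge at b away from b. When {v, u} loses
  -- to {b, a}, an orientation v → u propagates to a → b, hence the negation. The
  -- argument k bounds the number of propagation steps.
  tail : ℕ → Fin n → Bool
  tail zero b = does (initial? b)
  tail (suc k) b = if does (hasPred? b) then not (tail k (pred b)) else does (initial? b)

  tail-loses : ∀ k {v b} → Loses v b → tail (suc k) b ≡ not (tail k v)
  tail-loses k {v} {b} l rewrite dec-true (hasPred? b) (v , l) | pred-unique l = refl

  tail-root : ∀ k {b} → ¬ HasPred b → tail k b ≡ does (initial? b)
  tail-root zero ¬h = refl
  tail-root (suc k) {b} ¬h rewrite dec-false (hasPred? b) ¬h = refl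

  -- Predecessors of partners are partners, so `initial-partner` propagates from the roots. This
  -- makes `tail` an orientation.
  tail-partner : ∀ k {a b} → Missing a b → tail k a ≡ not (tail k b)
  tail-partner zero ab = initial-partner ab
  tail-partner (suc k) {a} {b} ab = go (hasPred? a)
    where
    go : Dec (HasPred a) → tail (suc k) a ≡ not (tail (suc k) b)
    go (yes h) = begin
      tail (suc k) a              ≡⟨ tail-loses k (pred-loses h) ⟩
      not (tail k (pred a))       ≡⟨ cong not (tail-partner k (pred-partner ab h)) ⟩
      not (not (tail k (pred b))) ≡⟨ cong not (tail-loses k (pred-loses (hasPred-partner ab h))) ⟨
      not (tail (suc k) b)        ∎
      where open ≡-Reasoning
    go (no ¬h) = begin
      tail (suc k) a            ≡⟨ tail-root (suc k) ¬h ⟩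
      does (initial? a)         ≡⟨ initial-partner ab ⟩
      not (does (initial? b))   ≡⟨ cong not (tail-root (suc k) (¬h ∘ hasPred-partner (missing-sym ab))) ⟨
      not (tail (suc k) b)      ∎
      where open ≡-Reasoning

  -- The recursion meets a root within `k` steps, and at a root the bound has no effect.
  tail-stable : ∀ k {b} → ¬ HasPred (fold b pred k) → tail k b ≡ tail (suc k) b
  tail-stable zero ¬h = sym (tail-root 1 ¬h)
  tail-stable (suc k) {b} ¬h = go (hasPred? b)
    where
    shift : fold b pred (suc k) ≡ fold (pred b) pred k
    shift = trans (cong (fold b pred) (+-comm 1 k)) (fold-+ b pred k)
    go : Dec (HasPred b) → tail (suc k) b ≡ tail (suc (suc k)) b
    go (yes h) = begin
      tail (suc k) b             ≡⟨ tail-loses k (pred-loses h) ⟩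
      not (tail k (pred b))      ≡⟨ cong not (tail-stable k (¬h ∘ subst HasPred (sym shift))) ⟩
      not (tail (suc k) (pred b)) ≡⟨ tail-loses (suc k) (pred-loses h) ⟨
      tail (suc (suc k)) b       ∎
      where open ≡-Reasoning
    go (no ¬hb) = trans (tail-root (suc k) ¬hb) (sym (tail-root (suc (suc k)) ¬hb))

  -- Acyclic case: completing the graph to a tournament

  module Acyclic (k : ℕ) (acyclic : ∀ b → ¬ HasPred (fold b pred k)) where

    tail-flips : ∀ {v b} → Loses v b → tail k b ≡ not (tail k v)
    tail-flips {v} {b} l = trans (tail-stable k (acyclic b)) (tail-loses k l)

    -- Such a `v` would make `a` opposed. As `b` beats `a`, `b` would be opposed too and, by
    -- `opposed⇒hasPred`, not a root.
    not-opposed : ∀ {a b v} → Missing b a → ¬ HasPred b → tail k b ≡ true → ¬ Witness v b a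
    not-opposed {a} {b} {v} ba ¬h tb w with initial? b | trans (sym (tail-root k ¬h)) tb
    ... | yes (a′ , ba′ , beats) | _ with refl ← missing-unique ba ba′ = refute beats
      where
      oa : Opposed a
      oa = b , v , missing-sym ba , w
      refute : ¬ Beats b a
      refute (inj₁ (_ , ¬oa)) = ¬oa oa
      refute (inj₂ (inj₁ ob , _)) = ¬h (opposed⇒hasPred ba ob oa)
      refute (inj₂ (inj₂ ¬oa , _)) = ¬oa oa
    ... | no _ | ()

    -- By `not-opposed`, `b` is not a root. For its predecessor `u`, `witnesses-missing` shows that
    -- `v` is the partner of `u`, and partners lose to partners.
    witness⇒loses : ∀ {a b v} → Missing b a → tail k b ≡ true → Witness v b a → Loses v a
    witness⇒loses {a} {b} {v} ba tb w = go (hasPred? b)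
      where
      go : Dec (HasPred b) → Loses v a
      go (no ¬h) = contradiction w (not-opposed ba ¬h tb)
      go (yes (u , l@(v′ , a′ , uv′ , ba′ , w₁ , w₂)))
        with refl ← missing-unique ba ba′
        with refl ← missing-unique (witnesses-missing w₁ w) uv′ = loses-partner uv′ ba l

    T : Rel (Fin n) 0ℓ
    T u v = Arc u v ⊎ (Missing u v × tail k u ≡ true)

    T? : Decidable T
    T? u v = arc? u v ⊎-dec (missing? u v ×-dec tail k u Bool.≟ true)

    T-asym : ∀ {u v} → T u v → ¬ T v u
    T-asym (inj₁ uv) (inj₁ vu) = noDigons uv vu
    T-asym (inj₁ uv) (inj₂ ((_ , _ , ¬uv) , _)) = ¬uv uv
    T-asym (inj₂ ((_ , _ , ¬vu) , _)) (inj₁ vu) = ¬vu vu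
    T-asym (inj₂ (uv , tu)) (inj₂ (_ , tv)) with trans (sym (tail-partner k uv)) tu
    ... | eq rewrite tv with () ← eq

    T-total : ∀ {u v} → u ≢ v → T u v ⊎ T v u
    T-total {u} {v} u≢v with missing? u v
    ... | no ¬uv with adjacent u≢v ¬uv
    ...   | inj₁ uv = inj₁ (inj₁ uv)
    ...   | inj₂ vu = inj₂ (inj₁ vu)
    T-total {u} {v} u≢v | yes uv with tail k u in tu | tail-partner k (missing-sym uv)
    ... | true | _ = inj₁ (inj₂ (uv , refl))
    ... | false | tv = inj₂ (inj₂ (missing-sym uv , tv))

    -- An original arc `x → w` would make `w` a second out-neighbor. If `x → w` is an oriented
    -- missing edge, `witness⇒loses` applies; the flips from `f` to `w` and from `w` to `x` cancel,
    -- so `f` is a tail like `x`.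
    dominates : ∀ {f w x} → w ≢ f → ¬ Arc f w → ¬ Second f w → Arc f x →
                T w x ⊎ (tail k f ≡ true × Loses f w)
    dominates {f} {w} {x} w≢f ¬fw ¬2 fx with T-total {w} {x} (λ { refl → ¬fw fx })
    ... | inj₁ wx = inj₁ wx
    ... | inj₂ (inj₁ xw) = contradiction (w≢f , ¬fw , x , fx , xw) ¬2
    ... | inj₂ (inj₂ (xw , tx)) = inj₂ (tf , l)
      where
      l : Loses f w
      l = witness⇒loses xw tx (fx , ¬reaches w≢f ¬fw ¬2)
      tf : tail k f ≡ true
      tf = trans (Bool.not-injective (trans (sym (tail-flips l)) (tail-partner k (missing-sym xw)))) tx

    -- Local median orders of the vertices other than `z`

    module _ {z y : Fin n} (zy : Arc z y) (toZ : ∀ {v} → v ≢ z → v ≢ y → Arc v z) where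

      ¬missing-z : ∀ {v} → ¬ Missing v z
      ¬missing-z {v} (v≢z , ¬vz , ¬zv) = ¬vz (toZ v≢z λ { refl → ¬zv zy })

      cost : Fin n → Fin n → ℕ
      cost = arcCost T? n y

      module _ {f : Fin n} {xs : List (Fin n)} (median : LocallyMedian cost (f ∷ xs))
        (perm : z ∷ f ∷ xs ↭ allFin n) where

        unique : Unique (z ∷ f ∷ xs)
        unique = Permₛ.Unique-resp-↭ (setoid (Fin n)) (↭⇒↭ₛ (↭-sym perm)) (Unique.allFin⁺ n)

        len : length (f ∷ xs) ≤ n
        len = <⇒≤ (≤-reflexive (trans (Perm.↭-length perm) (length-tabulate id)))

        f≢z : f ≢ z
        f≢z with (z≢f ∷ _) ∷ _ ← unique = ≢-sym z≢f

        ∈xs : ∀ {v} → v ≢ z → v ≢ f → v ∈ₗ xs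
        ∈xs {v} v≢z v≢f with Perm.∈-resp-↭ (↭-sym perm) (∈-allFin v)
        ... | here v≡z = contradiction v≡z v≢z
        ... | there (here v≡f) = contradiction v≡f v≢f
        ... | there (there v∈xs) = v∈xs

        y-good : f ≢ y → Arc f y ⊎ Second f y
        y-good f≢y with arc? f y
        ... | yes fy = inj₁ fy
        ... | no ¬fy = inj₂ (≢-sym f≢y , ¬fy , z , toZ f≢z f≢y , zy)

        Counted : Set
        Counted = ∑ xs (𝟙 ∘ arc? f) + ∑ xs (λ w → 𝟙 (w ≟ y)) ≤ ∑ xs (𝟙 ∘ second? f)

        -- The added out-neighbor g of f pays for x, the only vertex that may be a
        -- second out-neighbor of f for the relation T but not in D.
        counted-forward : ∀ {x} → tail k f ≡ true → Loses f x → Counted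
        counted-forward {x} tf l@(g , _ , fg@(f≢g , ¬fg , ¬gf) , _) = +-cancelˡ-≤ 1 _ _ (begin
          1 + (∑ xs (𝟙 ∘ arc? f) + e)
            ≤⟨ +-monoˡ-≤ (∑ xs (𝟙 ∘ arc? f) + e) (1≤∑-𝟙 (_≟ g) (∈xs g≢z (≢-sym f≢g)) refl) ⟩
          ∑ xs (λ w → 𝟙 (w ≟ g)) + (∑ xs (𝟙 ∘ arc? f) + e)
            ≡⟨ +-assoc (∑ xs (λ w → 𝟙 (w ≟ g))) _ e ⟨
          ∑ xs (λ w → 𝟙 (w ≟ g)) + ∑ xs (𝟙 ∘ arc? f) + e
            ≡⟨ cong (_+ e) (∑-+ (λ w → 𝟙 (w ≟ g)) (𝟙 ∘ arc? f) xs) ⟨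
          ∑ xs (λ w → 𝟙 (w ≟ g) + 𝟙 (arc? f w)) + e
            ≤⟨ +-monoˡ-≤ e (∑-mono xs λ {w} _ → 𝟙-pack (O⁺? w) (w ≟ g) (arc? f w) inj₂ inj₁ λ { refl → ¬fg }) ⟩
          ∑ xs (𝟙 ∘ O⁺?) + e
            ≤⟨ Feed.feed T? O⁺? Q⁺? T-asym n y f O⇒T bad⇒T y-good′ xs median (unique-tail unique) len ⟩
          ∑ xs (𝟙 ∘ Q⁺?)
            ≤⟨ ∑-mono xs (λ {w} _ → 𝟙-cover (Q⁺? w) (w ≟ x) (second? f w) [ inj₂ , inj₁ ]′) ⟩
          ∑ xs (λ w → 𝟙 (w ≟ x) + 𝟙 (second? f w))
            ≡⟨ ∑-+ (λ w → 𝟙 (w ≟ x)) (𝟙 ∘ second? f) xs ⟩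
          ∑ xs (λ w → 𝟙 (w ≟ x)) + ∑ xs (𝟙 ∘ second? f)
            ≤⟨ +-monoˡ-≤ (∑ xs (𝟙 ∘ second? f)) (∑-𝟙-≤1 (_≟ x) (λ { refl refl → refl }) (unique-tail (unique-tail unique))) ⟩
          1 + ∑ xs (𝟙 ∘ second? f) ∎)
          where
          open ≤-Reasoning
          e = ∑ xs (λ w → 𝟙 (w ≟ y))
          unique-tail : ∀ {v vs} → Unique {A = Fin n} (v ∷ vs) → Unique vs
          unique-tail (_ ∷ u) = u
          g≢z : g ≢ z
          g≢z refl = ¬missing-z fg
          O⁺ Q⁺ : U.Pred (Fin n) 0ℓ
          O⁺ w = Arc f w ⊎ w ≡ g
          Q⁺ w = Second f w ⊎ w ≡ x
          O⁺? : U.Decidable O⁺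
          O⁺? w = arc? f w ⊎-dec w ≟ g
          Q⁺? : U.Decidable Q⁺
          Q⁺? w = second? f w ⊎-dec w ≟ x
          O⇒T : ∀ {w} → O⁺ w → T f w
          O⇒T (inj₁ fw) = inj₁ fw
          O⇒T (inj₂ refl) = inj₂ (fg , tf)
          y-good′ : f ≢ y → O⁺ y ⊎ Q⁺ y
          y-good′ f≢y with y-good f≢y
          ... | inj₁ fy = inj₁ (inj₁ fy)
          ... | inj₂ 2y = inj₂ (inj₁ 2y)
          -- `Q⁺` contains the only possible exception: by `loses-functional` a vertex to which `f`
          -- loses is `x`, and by `loses-only` so is an out-neighbor of `g` that `f` does not reach.
          bad⇒T : ∀ {w v} → w ≢ f → ¬ O⁺ w × ¬ Q⁺ w → O⁺ v → T w v
          bad⇒T w≢f (¬o , ¬q) (inj₁ fv) with dominates w≢f (¬o ∘ inj₁) (¬q ∘ inj₁) fv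
          ... | inj₁ wv = wv
          ... | inj₂ (_ , l′) = contradiction (inj₂ (loses-functional l′ l)) ¬q
          bad⇒T {w} w≢f (¬o , ¬q) (inj₂ refl) with adjacent (¬o ∘ inj₂)
            (λ wg → w≢f (missing-unique (missing-sym wg) (missing-sym fg)))
          ... | inj₁ wg = inj₁ wg
          ... | inj₂ gw = contradiction
            (inj₂ (loses-only l fg gw (¬reaches w≢f (¬o ∘ inj₁) (¬q ∘ inj₁)))) ¬q

        counted-otherwise : ¬ (tail k f ≡ true × ∃ (Loses f)) → Counted
        counted-otherwise ¬forward with _ ∷ u ← unique =
          Feed.feed T? (arc? f) (second? f) T-asym n y f inj₁ bad⇒T y-good xs median u len
          where
          bad⇒T : ∀ {w v} → w ≢ f → ¬ Arc f w × ¬ Second f w → Arc f v → T w v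
          bad⇒T w≢f (¬fw , ¬2) fv with dominates w≢f ¬fw ¬2 fv
          ... | inj₁ wv = wv
          ... | inj₂ (tf , l) = contradiction (tf , _ , l) ¬forward

        counted : Counted
        counted with tail k f Bool.≟ true ×-dec any? (loses? f)
        ... | yes (tf , x , l) = counted-forward tf l
        ... | no ¬forward = counted-otherwise ¬forward

        largeOff-feed : LargeOff z f
        largeOff-feed = begin
          # (arc? f)                                               ≡⟨ split (arc? f) ⟩
          𝟙 (arc? f z) + (𝟙 (arc? f f) + ∑ xs (𝟙 ∘ arc? f))        ≡⟨ cong (λ e → 𝟙 (arc? f z) + (e + ∑ xs (𝟙 ∘ arc? f))) (𝟙-false (arc? f f) noLoops) ⟩
          𝟙 (arc? f z) + ∑ xs (𝟙 ∘ arc? f)                         ≤⟨ +-monoˡ-≤ _ (z-paid (f ≟ y)) ⟩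
          ∑ xs (λ w → 𝟙 (w ≟ y)) + ∑ xs (𝟙 ∘ arc? f)               ≡⟨ +-comm (∑ xs (λ w → 𝟙 (w ≟ y))) _ ⟩
          ∑ xs (𝟙 ∘ arc? f) + ∑ xs (λ w → 𝟙 (w ≟ y))               ≤⟨ counted ⟩
          ∑ xs (𝟙 ∘ second? f)                                     ≤⟨ ∑-mono xs (λ {w} w∈xs → 𝟙-mono (second? f w) (secondOff? z f w) (≢z w∈xs ,_)) ⟩
          ∑ xs (𝟙 ∘ secondOff? z f)                                ≤⟨ ≤-trans (m≤n+m _ (𝟙 (secondOff? z f f))) (m≤n+m _ (𝟙 (secondOff? z f z))) ⟩
          𝟙 (secondOff? z f z) + (𝟙 (secondOff? z f f) + ∑ xs (𝟙 ∘ secondOff? z f)) ≡⟨ split (secondOff? z f) ⟨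
          # (secondOff? z f) ∎
          where
          open ≤-Reasoning
          split : ∀ {P : U.Pred (Fin n) 0ℓ} (P? : U.Decidable P) → # P? ≡ 𝟙 (P? z) + (𝟙 (P? f) + ∑ xs (𝟙 ∘ P?))
          split P? = trans (#-∑ P?) (sym (∑-↭ (𝟙 ∘ P?) perm))
          ≢z : ∀ {w} → w ∈ₗ xs → w ≢ z
          ≢z w∈xs refl with z∉ ∷ _ ← unique = All.lookup z∉ (there w∈xs) refl
          -- For `f ≢ y` the extra count of `y` in `Counted` pays for a possible arc `f → z`; for
          -- `f ≡ y` the arc `z → y` excludes one.
          z-paid : Dec (f ≡ y) → 𝟙 (arc? f z) ≤ ∑ xs (λ w → 𝟙 (w ≟ y))
          z-paid (yes refl) = subst (_≤ _) (sym (𝟙-false (arc? f z) (noDigons zy))) z≤n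
          z-paid (no f≢y) = ≤-trans (𝟙≤1 (arc? f z))
            (1≤∑-𝟙 (_≟ y) (∈xs (λ { refl → noLoops zy }) (≢-sym f≢y)) refl)

      cost-bound : ∀ u v → cost u v ≤ n * 1 + 1
      cost-bound u v = +-mono-≤ (*-monoʳ-≤ n (𝟙≤1 (T? u v))) (𝟙≤1 (v ≟ y))

      largeOff-exists : ∃ λ f → f ≢ z × LargeOff z f
      largeOff-exists with ys , zs , eq ← ∈-∃++ (∈-allFin z)
        with locallyMedian-exists cost cost-bound (ys ++ zs)
      -- An empty order would make `z` the only vertex, but `y` differs from it.
      ... | [] , perm , _ = contradiction
        (Perm.∈-resp-↭ (↭-trans (↭-reflexive eq) (↭-trans (Perm.shift z ys zs) (prep z (↭-sym perm)))) (∈-allFin y))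
        λ { (here refl) → noLoops zy }
      ... | f ∷ xs , perm , median = f , f≢z median perm′ , largeOff-feed median perm′
        where
        perm′ : z ∷ f ∷ xs ↭ allFin n
        perm′ = ↭-trans (prep z perm) (↭-trans (↭-sym (Perm.shift z ys zs)) (↭-reflexive (sym eq)))

-- Removing a cycle of the relation Loses

#-injection : {P Q : Fin n → Set} (P? : U.Decidable P) (Q? : U.Decidable Q) (φ : Fin n → Fin n) →
              (∀ {u} → P u → Q (φ u)) → (∀ {u v} → P u → P v → φ u ≡ φ v → u ≡ v) →
              # P? ≤ # Q?
#-injection {n} {P} P? Q? φ P⇒Q inj = begin
  # P?                               ≡⟨ trans (#-∑ P?) (sym (length-filter P? (allFin n))) ⟩
  length (filter P? (allFin n))      ≡⟨ length-map φ (filter P? (allFin n)) ⟨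
  length (map φ (filter P? (allFin n)))
    ≤⟨ length≤∣∣ (unique-map (All.all-filter P? (allFin n)) (Unique.filter⁺ P? (Unique.allFin⁺ n)))
                (All.map⁺ (All.map (comprehension⁺ Q? ∘ P⇒Q) (All.all-filter P? (allFin n)))) ⟩
  # Q? ∎
  where
  open ≤-Reasoning
  unique-map : ∀ {xs} → All P xs → Unique xs → Unique (map φ xs)
  unique-map [] [] = []
  unique-map (px ∷ pxs) (x∉xs ∷ u) =
    All.map⁺ (All.zipWith (λ (py , x≢y) → x≢y ∘ inj px py) (pxs , x∉xs)) ∷ unique-map pxs u

least : {P : ℕ → Set} → U.Decidable P → ∀ l →
        (∀ j → j < l → ¬ P j) ⊎ ∃ λ k → P k × ∀ j → j < k → ¬ P j
least P? zero = inj₁ λ _ ()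
least {P} P? (suc l) with least P? l
... | inj₂ found = inj₂ found
... | inj₁ none with P? l
...   | yes pl = inj₂ (l , pl , none)
...   | no ¬pl = inj₁ λ j j<1+l → [ none j , (λ { refl → ¬pl }) ]′ (m≤n⇒m<n∨m≡n (s≤s⁻¹ j<1+l))

module Cycle (D : OrientedGraph n)
  (missing-unique : ∀ {a b c} → Adjacency.Missing D a b → Adjacency.Missing D a c → b ≡ c)
  (c : Fin n) (m′ : ℕ) (closed : fold c (Matching.pred D missing-unique) (suc m′) ≡ c)
  (hasPred : ∀ i → Matching.HasPred D missing-unique (fold c (Matching.pred D missing-unique) i)) where
  open OrientedGraph D
  open Adjacency D
  open Matching D missing-unique

  m : ℕ
  m = suc m′

  -- Following `pred` goes against `Loses` and therefore along arcs. `m` is a period of `q`, not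
  -- necessarily the least.
  q : ℕ → Fin n
  q i = fold c pred i

  q-+ : ∀ i j → q (i + j) ≡ fold (q j) pred i
  q-+ i j = fold-+ c pred i

  q-multiple : ∀ t → q (t * m) ≡ c
  q-multiple zero = refl
  q-multiple (suc t) = trans (q-+ m (t * m)) (trans (cong (λ x → fold x pred m) (q-multiple t)) closed)

  q-period : ∀ i t → q (i + t * m) ≡ q i
  q-period i t = trans (q-+ i (t * m)) (cong (λ x → fold x pred i) (q-multiple t))

  K : U.Pred (Fin n) 0ℓ
  K x = ∃ λ (i : Fin m) → x ≡ q (toℕ i)

  K? : U.Decidable K
  K? x = any? λ i → x ≟ q (toℕ i)

  q∈K : ∀ i → K (q i)
  q∈K i = fromℕ< (m%n<n i m) , (begin
    q i                              ≡⟨ cong q (m≡m%n+[m/n]*n i m) ⟩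
    q (i % m + i / m * m)            ≡⟨ q-period (i % m) (i / m) ⟩
    q (i % m)                        ≡⟨ cong q (toℕ-fromℕ< (m%n<n i m)) ⟨
    q (toℕ (fromℕ< (m%n<n i m)))     ∎)
    where open ≡-Reasoning

  q-ahead : ∀ l i → ∃ λ t → q l ≡ q (t + i)
  -- Adding `i` periods to `l` gives an index of at least `i`.
  q-ahead l i = l + i * m′ , trans (sym (q-period l i)) (cong q (rearrange l i m′))
    where
    rearrange : ∀ l i m′ → l + i * suc m′ ≡ (l + i * m′) + i
    rearrange = solve-∀

  q-loses : ∀ i → Loses (q (suc i)) (q i)
  q-loses i = pred-loses (hasPred i)

  q-arc : ∀ i → Arc (q i) (q (suc i))
  q-arc i = loses-arc (q-loses i)

  -- `q (suc i)` loses to `q i` and so does not reach it, which rules out `x → q i`.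
  pull : ∀ {x} i → ¬ Missing (q i) x → Arc (q (suc i)) x → Arc (q i) x
  pull {x} i ¬miss vx with _ , _ , _ , _ , (_ , ¬vb) , _ ← q-loses i
    with adjacent {q i} {x} (λ { refl → noDigons (q-arc i) vx }) ¬miss
  ... | inj₁ bx = bx
  ... | inj₂ xb = contradiction (inj₂ (x , vx , xb)) ¬vb

  missing-shift : ∀ t {i j} → Missing (q i) (q j) → Missing (q (t + i)) (q (t + j))
  missing-shift zero ij = ij
  missing-shift (suc t) {i} ij = pred-partner (missing-shift t ij) (hasPred (t + i))

  Antipodal : ℕ → Set
  Antipodal j = Missing (q 0) (q (suc j))

  antipodal-from : ∀ j i → Missing (q i) (q (suc j + i)) → Antipodal j
  -- Shifting by `i * m′` turns the offset `i` into `i * m`, a multiple of the period.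
  antipodal-from j i miss = subst₂ Missing
    (trans (cong q (rearrange i m′ 0)) (q-period 0 i))
    (trans (cong q (rearrange i m′ (suc j))) (q-period (suc j) i))
    (missing-shift (i * m′) {i} {suc j + i} miss)
    where
    rearrange : ∀ i m′ j → i * m′ + (j + i) ≡ j + i * suc m′
    rearrange = solve-∀

  -- The arcs from `q i` extend one vertex at a time: an arc back from the next vertex could be
  -- pulled to the present one, against the arc just found.
  short-arc : ∀ j → (∀ l → l ≤ j → ¬ Antipodal l) → ∀ i → Arc (q i) (q (suc j + i))
  short-arc zero _ i = q-arc i
  short-arc (suc j) ¬anti i with short-arc j (λ l l≤j → ¬anti l (m≤n⇒m≤1+n l≤j)) i
  ... | xb with adjacent {q i} {q (suc (suc j) + i)}
        (λ x≡v → noDigons (q-arc (suc j + i)) (subst (λ v → Arc v (q (suc j + i))) x≡v xb))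
        (¬anti (suc j) ≤-refl ∘ antipodal-from (suc j) i)
  ...   | inj₁ xv = xv
  ...   | inj₂ vx = contradiction (pull (suc j + i) (λ (_ , _ , ¬xb) → ¬xb xb) vx) (noDigons xb)

  -- Without a missing pair, `short-arc` would lead all the way round from `c` to itself.
  antipode : ∃ λ k → Antipodal k × ∀ j → j < k → ¬ Antipodal j
  antipode with least (λ j → missing? (q 0) (q (suc j))) m
  ... | inj₂ found = found
  ... | inj₁ none = contradiction
    (subst (Arc c) (trans (cong q (+-identityʳ m)) closed) (short-arc m′ (λ l l≤m′ → none l (s≤s l≤m′)) 0)) noLoops

  -- The cycle is a circular tournament: q i dominates the next k vertices, is
  -- dominated by the previous k, and its missing partner lies in between.
  k : ℕ
  k = proj₁ antipode

  arc-ahead : ∀ j i → j < k → Arc (q i) (q (suc j + i))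
  arc-ahead j i j<k = short-arc j (λ l l≤j → proj₂ (proj₂ antipode) l (≤-<-trans l≤j j<k)) i

  q-missing : ∀ i → Missing (q i) (q (suc k + i))
  q-missing i = subst₂ (λ a b → Missing (q a) (q b)) (+-identityʳ i) (+-comm i (suc k))
    (missing-shift i {0} {suc k} (proj₁ (proj₂ antipode)))

  q-round : ∀ i → q (suc k + (suc k + i)) ≡ q i
  q-round i = sym (missing-unique (missing-sym (q-missing i)) (q-missing (suc k + i)))

  arc-back : ∀ j i → j < k → Arc (q (suc k + (suc j + i))) (q i)
  arc-back j i j<k = subst (Arc _)
    (trans (cong q (trans (rearrange j d k i) (cong (λ l → suc k + (suc l + i)) (m+[n∸m]≡n j<k)))) (q-round i))
    (arc-ahead d (suc k + (suc j + i)) d<k)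
    where
    -- From the tail of the arc, `suc d` further steps complete the round of length `2 * suc k`
    -- given by `q-round`.
    d = k ∸ suc j
    d<k : d < k
    d<k = ∸-monoʳ-< (s≤s z≤n) j<k
    rearrange : ∀ j d k i → suc d + (suc k + (suc j + i)) ≡ suc k + (suc (suc j + d) + i)
    rearrange = solve-∀

  K-partner : ∀ {x w} → K x → Missing x w → K w
  K-partner (i , refl) xw = subst K (missing-unique (q-missing (toℕ i)) xw) (q∈K (suc k + toℕ i))

  -- Missing partners of vertices in `K` lie in `K`, so `pull` carries an arc to `x` backwards
  -- around the whole cycle.
  out-uniform : ∀ {u v x} → K u → K v → ¬ K x → Arc u x → Arc v x
  out-uniform {x = x} (i , refl) (j , refl) ¬Kx ux with t , eq ← q-ahead (toℕ i) (toℕ j) =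
    down t (subst (λ u → Arc u x) eq ux)
    where
    down : ∀ t → Arc (q (t + toℕ j)) x → Arc (q (toℕ j)) x
    down zero a = a
    down (suc t) a = down t (pull (t + toℕ j) (¬Kx ∘ K-partner (q∈K (t + toℕ j))) a)

  in-uniform : ∀ {u v x} → K u → K v → ¬ K x → Arc x u → Arc x v
  in-uniform {v = v} {x} Ku Kv ¬Kx xu with adjacent {v} {x} (λ { refl → ¬Kx Kv }) (¬Kx ∘ K-partner Kv)
  ... | inj₁ vx = contradiction (out-uniform Kv Ku ¬Kx vx) (noDigons xu)
  ... | inj₂ xv = xv

  reduce : ∀ s x → q (s * (suc k + suc k) + x) ≡ q x
  reduce zero x = refl
  reduce (suc s) x = trans (cong q (rearrange k (s * (suc k + suc k)) x))
    (trans (q-round (s * (suc k + suc k) + x)) (reduce s x))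
    where
    rearrange : ∀ k r x → (suc k + suc k + r) + x ≡ suc k + (suc k + (r + x))
    rearrange = solve-∀

  -- Modulo the round length, offset `0` is `q i` itself, `suc k` its missing partner, and every
  -- larger one an in-neighbor by `arc-back`.
  out-within : ∀ i {w} → K w → Arc (q i) w → ∃ λ j → j < k × w ≡ q (suc j + i)
  out-within i (l , refl) fw with t , eq ← q-ahead (toℕ l) i =
    locate (t % h) (m%n<n t h) (trans eq (begin
      q (t + i)                        ≡⟨ cong (λ t → q (t + i)) (m≡m%n+[m/n]*n t h) ⟩
      q (t % h + t / h * h + i)        ≡⟨ cong q (rearrange (t % h) (t / h * h) i) ⟩
      q (t / h * h + (t % h + i))      ≡⟨ reduce (t / h) (t % h + i) ⟩
      q (t % h + i)                    ∎))
    where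
    open ≡-Reasoning
    h = suc k + suc k
    rearrange : ∀ r s i → (r + s) + i ≡ s + (r + i)
    rearrange = solve-∀
    locate : ∀ r → r < h → q (toℕ l) ≡ q (r + i) → ∃ λ j → j < k × q (toℕ l) ≡ q (suc j + i)
    locate zero _ eq = contradiction (subst (Arc _) eq fw) noLoops
    locate (suc r) r<h eq with <-cmp r k
    ... | tri< r<k _ _ = r , r<k , eq
    ... | tri≈ _ refl _ = contradiction (subst (Arc _) eq fw) (proj₁ (proj₂ (q-missing i)))
    ... | tri> _ _ k<r = contradiction
      (subst (λ w → Arc w (q i)) (sym eq′) (arc-back j i j<k)) (noDigons fw)
      where
      j = r ∸ suc k
      k+j : suc k + j ≡ r
      k+j = m+[n∸m]≡n k<r
      j<k : j < k
      j<k = s≤s⁻¹ (+-cancelˡ-≤ (suc k) _ _ (≤-trans (≤-reflexive (trans (+-suc (suc k) (suc j)) (cong suc (trans (+-suc (suc k) j) (cong suc k+j))))) r<h))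
      eq′ : q (toℕ l) ≡ q (suc k + (suc j + i))
      eq′ = trans eq (cong q (trans (cong (λ r → suc r + i) (sym k+j)) (rearrange′ k j i)))
        where
        rearrange′ : ∀ k j i → suc (suc k + j) + i ≡ suc k + (suc j + i)
        rearrange′ = solve-∀

  -- Takes the out-neighbors of a vertex within `K`, at offsets `1` to `k`, to offsets `k + 1` to
  -- `2 * k`, which its partner and in-neighbors occupy.
  φ : Fin n → Fin n
  φ w = fold w pred k

  φ-second : ∀ {f w} → K f → K w → Arc f w → Second f (φ w) × K (φ w)
  φ-second (a , refl) Kw fw with j , j<k , refl ← out-within (toℕ a) Kw fw =
    subst (λ v → Second f v × K v) (q-+ k (suc j + i))
      ((φw≢f j j<k , ¬f→φw j j<k , q (suc j + i) , fw , w→φw k j<k ≤-refl) , q∈K (k + (suc j + i)))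
    where
    i = toℕ a
    f = q i
    w→φw : ∀ l → j < l → l ≤ k → Arc (q (suc j + i)) (q (l + (suc j + i)))
    w→φw (suc l) _ l<k = arc-ahead l (suc j + i) l<k
    shift : ∀ j → suc k + (j + i) ≡ k + (suc j + i)
    shift j = sym (+-suc k (j + i))
    apart : ∀ j → j < k → Missing f (q (suc k + (j + i))) ⊎ Arc (q (suc k + (j + i))) f
    apart zero _ = inj₁ (q-missing i)
    apart (suc j) j<k = inj₂ (arc-back j i (<⇒≤ j<k))
    φw≢f : ∀ j → j < k → q (k + (suc j + i)) ≢ f
    φw≢f j j<k eq with apart j j<k | trans (cong q (shift j)) eq
    ... | inj₁ (f≢ , _) | eq′ = f≢ (sym eq′)
    ... | inj₂ arc | eq′ = noLoops (subst (λ v → Arc v f) eq′ arc)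
    ¬f→φw : ∀ j → j < k → ¬ Arc f (q (k + (suc j + i)))
    ¬f→φw j j<k arc with apart j j<k | subst (Arc f) (cong q (sym (shift j))) arc
    ... | inj₁ (_ , ¬arc , _) | arc′ = ¬arc arc′
    ... | inj₂ back | arc′ = noDigons back arc′

  φ-injective : ∀ {u v} → K u → K v → φ u ≡ φ v → u ≡ v
  φ-injective Ku Kv eq = trans (sym (undo Ku)) (trans (cong (λ x → fold x pred (k * m′)) eq) (undo Kv))
    where
    rearrange : ∀ k m′ i → k * m′ + (k + i) ≡ i + k * suc m′
    rearrange = solve-∀
    -- After the `k` steps of `φ`, `k * m′` more complete `k` periods.
    undo : ∀ {u} → K u → fold (φ u) pred (k * m′) ≡ u
    undo (i , refl) = begin
      fold (fold (q (toℕ i)) pred k) pred (k * m′)   ≡⟨ cong (λ x → fold x pred (k * m′)) (q-+ k (toℕ i)) ⟨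
      fold (q (k + toℕ i)) pred (k * m′)             ≡⟨ q-+ (k * m′) (k + toℕ i) ⟨
      q (k * m′ + (k + toℕ i))                       ≡⟨ cong q (rearrange k m′ (toℕ i)) ⟩
      q (toℕ i + k * m)                              ≡⟨ q-period (toℕ i) k ⟩
      q (toℕ i)                                      ∎
      where open ≡-Reasoning

  transitive : OrientedGraph n
  transitive = record
    { Arc = λ u v → (¬ (K u × K v) × Arc u v) ⊎ (K u × K v × u Fin.< v)
    ; arc? = λ u v → (¬? (K? u ×-dec K? v) ×-dec arc? u v) ⊎-dec (K? u ×-dec K? v ×-dec u Fin.<? v)
    ; noLoops = λ where
        (inj₁ (_ , uu)) → noLoops uu
        (inj₂ (_ , _ , u<u)) → Fin.<-irrefl refl u<u
    ; noDigons = λ where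
        (inj₁ (_ , uv)) (inj₁ (_ , vu)) → noDigons uv vu
        (inj₁ (¬K , _)) (inj₂ (Kv , Ku , _)) → ¬K (Ku , Kv)
        (inj₂ (Ku , Kv , _)) (inj₁ (¬K , _)) → ¬K (Kv , Ku)
        (inj₂ (_ , _ , u<v)) (inj₂ (_ , _ , v<u)) → Fin.<-asym u<v v<u
    }

  module D′ = OrientedGraph transitive
  module A′ = Adjacency transitive

  missing-refines : ∀ {u v} → A′.Missing u v → Missing u v × ¬ (K u × K v)
  missing-refines {u} {v} (u≢v , ¬uv , ¬vu) =
    (u≢v , ¬uv ∘ inj₁ ∘ (¬K ,_) , ¬vu ∘ inj₁ ∘ (λ vu → (λ (Kv , Ku) → ¬K (Ku , Kv)) , vu)) , ¬K
    where
    ¬K : ¬ (K u × K v)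
    ¬K (Ku , Kv) with Fin.<-cmp u v
    ... | tri< u<v _ _ = ¬uv (inj₂ (Ku , Kv , u<v))
    ... | tri≈ _ u≡v _ = u≢v u≡v
    ... | tri> _ _ v<u = ¬vu (inj₂ (Kv , Ku , v<u))

  module _ {z : Fin n} (¬Kz : ¬ K z) where

    -- A path from `f` through a new arc inside `K` yields no second out-neighbor: once `f`
    -- dominates one vertex of `K`, it dominates all of them.
    pullback-outside : ∀ {f} → ¬ K f → A′.LargeOff z f → LargeOff z f
    pullback-outside {f} ¬Kf large = begin
      # (arc? f)                  ≤⟨ #-mono (arc? f) (D′.arc? f) (λ fu → inj₁ (¬Kf ∘ proj₁ , fu)) ⟩
      # (D′.arc? f)               ≤⟨ large ⟩
      # (A′.secondOff? z f)       ≤⟨ #-mono (A′.secondOff? z f) (secondOff? z f) second ⟩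
      # (secondOff? z f)          ∎
      where
      open ≤-Reasoning
      second : ∀ {u} → u ≢ z × A′.Second f u → u ≢ z × Second f u
      second (u≢z , u≢f , ¬fu , w , inj₂ (Kf , _) , _) = contradiction Kf ¬Kf
      second (u≢z , u≢f , ¬fu , w , inj₁ (_ , fw) , inj₁ (_ , wu)) =
        u≢z , u≢f , ¬fu ∘ inj₁ ∘ (¬Kf ∘ proj₁ ,_) , w , fw , wu
      second (u≢z , u≢f , ¬fu , w , inj₁ (_ , fw) , inj₂ (Kw , Ku , _)) =
        contradiction (inj₁ (¬Kf ∘ proj₁ , in-uniform Kw Ku ¬Kf fw)) ¬fu

    -- The out-neighbors in `K`, possibly lost in the new graph, are matched by `φ` with second
    -- out-neighbors in `K`, of which the new graph has none.
    pullback-inside : ∀ {f} → K f → A′.LargeOff z f → LargeOff z f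
    pullback-inside {f} Kf large = begin
      # (arc? f)
        ≤⟨ #-cover (arc? f) (D′.arc? f) outK? out ⟩
      # (D′.arc? f) + # outK?
        ≤⟨ +-mono-≤ large (#-injection outK? secondK? φ image (λ (_ , Ku) (_ , Kv) → φ-injective Ku Kv)) ⟩
      # (A′.secondOff? z f) + # secondK?
        ≤⟨ #-pack (secondOff? z f) (A′.secondOff? z f) secondK? second proj₁ (λ (_ , 2u) (_ , Ku) → second⇒¬K 2u Ku) ⟩
      # (secondOff? z f) ∎
      where
      open ≤-Reasoning
      outK? : U.Decidable (λ u → Arc f u × K u)
      outK? u = arc? f u ×-dec K? u
      secondK? : U.Decidable (λ u → (u ≢ z × Second f u) × K u)
      secondK? u = secondOff? z f u ×-dec K? u
      out : ∀ {u} → Arc f u → D′.Arc f u ⊎ (Arc f u × K u)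
      out {u} fu with K? u
      ... | yes Ku = inj₂ (fu , Ku)
      ... | no ¬Ku = inj₁ (inj₁ (¬Ku ∘ proj₂ , fu))
      image : ∀ {u} → Arc f u × K u → (φ u ≢ z × Second f (φ u)) × K (φ u)
      image (fu , Ku) with 2φ , Kφ ← φ-second Kf Ku fu = ((λ { refl → ¬Kz Kφ }) , 2φ) , Kφ
      second⇒¬K : ∀ {u} → A′.Second f u → ¬ K u
      second⇒¬K (u≢f , ¬fu , w , inj₂ (_ , Kw , f<w) , inj₂ (_ , _ , w<u)) Ku =
        ¬fu (inj₂ (Kf , Ku , Fin.<-trans f<w w<u))
      second⇒¬K (u≢f , ¬fu , w , inj₂ (_ , Kw , _) , inj₁ (¬K , _)) Ku = ¬K (Kw , Ku)
      second⇒¬K (u≢f , ¬fu , w , inj₁ (¬K , _) , inj₂ (Kw , _)) Ku = ¬K (Kf , Kw)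
      second⇒¬K (u≢f , ¬fu , w , inj₁ (¬K , fw) , inj₁ (_ , wu)) Ku =
        noDigons wu (out-uniform Kf Ku (¬K ∘ (Kf ,_)) fw)
      second : ∀ {u} → u ≢ z × A′.Second f u → u ≢ z × Second f u
      second {u} (u≢z , 2u@(u≢f , ¬fu , w , fw , wu)) = u≢z , u≢f , ¬fu′ , w , path fw wu
        where
        ¬Ku : ¬ K u
        ¬Ku = second⇒¬K 2u
        ¬fu′ : ¬ Arc f u
        ¬fu′ fu = ¬fu (inj₁ (¬Ku ∘ proj₂ , fu))
        path : D′.Arc f w → D′.Arc w u → Arc f w × Arc w u
        path _ (inj₂ (_ , Ku , _)) = contradiction Ku ¬Ku
        path (inj₁ (_ , fw)) (inj₁ (_ , wu)) = fw , wu
        -- Here `f → w` is a new arc, but by homogeneity `f` itself then dominates `u`.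
        path (inj₂ (_ , Kw , _)) (inj₁ (_ , wu)) = contradiction (out-uniform Kw Kf ¬Ku wu) ¬fu′

    pullback : ∀ {f} → A′.LargeOff z f → LargeOff z f
    pullback {f} large = [ (λ Kf → pullback-inside Kf large) , (λ ¬Kf → pullback-outside ¬Kf large) ]′ (toSum (K? f))

-- Induction on the number of vertices with a missing partner

module _ (D : OrientedGraph n) where
  open OrientedGraph D
  open Adjacency D

  incomplete? : U.Decidable (λ u → ∃ (Missing u))
  incomplete? u = any? (missing? u)

  IsMatchingOff : Fin n → Fin n → Set
  IsMatchingOff z y =
    (∀ {a b c} → Missing a b → Missing a c → b ≡ c) × Arc z y × (∀ {v} → v ≢ z → v ≢ y → Arc v z)

largeOff-matching : ∀ (D : OrientedGraph n) {z y} → IsMatchingOff D z y →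
                    ∃ λ f → f ≢ z × Adjacency.LargeOff D z f
largeOff-matching {n} D = go (# (incomplete? D)) D ≤-refl
  where
  go : ∀ l (D : OrientedGraph n) → # (incomplete? D) ≤ l → ∀ {z y} → IsMatchingOff D z y →
       ∃ λ f → f ≢ z × Adjacency.LargeOff D z f
  go l D bound {z} {y} (missing-unique , zy , toZ)
    with all? (λ b → ¬? (Matching.hasPred? D missing-unique (fold b (Matching.pred D missing-unique) n)))
  ... | yes acyclic = Matching.Acyclic.largeOff-exists D missing-unique n acyclic zy toZ
  ... | no ¬acyclic
    with b , ¬¬h ← ¬∀⟶∃¬ n _ (λ b → ¬? (Matching.hasPred? D missing-unique (fold b (Matching.pred D missing-unique) n))) ¬acyclic
    -- Two of the `n + 1` iterates coincide, and the walk is periodic from there on.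
    with i , j , i<j , eq ← pigeonhole (n<1+n n) (λ i → fold b (Matching.pred D missing-unique) (toℕ i)) =
    step l bound
    where
    open OrientedGraph D
    open Adjacency D
    open Matching D missing-unique
    c = fold b pred (toℕ i)
    m′ = toℕ j ∸ suc (toℕ i)
    m+i : suc m′ + toℕ i ≡ toℕ j
    m+i = trans (+-comm (suc m′) (toℕ i)) (trans (+-suc (toℕ i) m′) (m+[n∸m]≡n i<j))
    closed : fold c pred (suc m′) ≡ c
    closed = trans (sym (fold-+ b pred (suc m′))) (trans (cong (fold b pred) m+i) (sym eq))
    root-stays : ∀ {x} t → ¬ HasPred x → fold x pred t ≡ x
    root-stays zero ¬h = refl
    root-stays {x} (suc t) ¬h = trans (cong pred (root-stays t ¬h)) (pred-root ¬h)
    hasPred-c : HasPred c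
    hasPred-c with hasPred? c
    ... | yes h = h
    -- From a root the walk never moves, so its `n`-th vertex would be the root `c`.
    ... | no ¬h = contradiction (λ h → ¬h (subst HasPred back h)) ¬¬h
      where
      back : fold b pred n ≡ c
      back = trans (cong (fold b pred) (sym (m∸n+n≡m (s≤s⁻¹ (toℕ<n i)))))
        (trans (fold-+ b pred (n ∸ toℕ i)) (root-stays (n ∸ toℕ i) ¬h))
    multiple : ∀ t → fold c pred (t * suc m′) ≡ c
    multiple zero = refl
    multiple (suc t) = trans (fold-+ c pred (suc m′)) (trans (cong (λ x → fold x pred (suc m′)) (multiple t)) closed)
    hasPred : ∀ t → HasPred (fold c pred t)
    hasPred t with hasPred? (fold c pred t)
    ... | yes h = h
    ... | no ¬h = contradiction (subst HasPred (sym back) hasPred-c) ¬h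
      where
      back : fold c pred t ≡ c
      back = trans (sym (root-stays (t * m′) ¬h)) (trans (sym (fold-+ c pred (t * m′)))
        (trans (cong (fold c pred) (trans (+-comm (t * m′) t) (sym (*-suc t m′)))) (multiple t)))
    open Cycle D missing-unique c m′ closed hasPred
    ¬Kz : ¬ K z
    ¬Kz (i , refl) = ¬vz′ (q-missing (toℕ i))
      where
      ¬vz′ : ∀ {v} → ¬ Missing (q (toℕ i)) v
      ¬vz′ (z≢v , ¬zv , ¬vz) = ¬vz (toZ (≢-sym z≢v) λ { refl → ¬zv zy })
    -- `c` drops out: its missing partner lies in `K`, where all pairs are now adjacent.
    fewer : # (incomplete? transitive) < # (incomplete? D)
    fewer = p⊂q⇒∣p∣<∣q∣
      ( (λ u∈ → let v , uv = comprehension⁻ (incomplete? transitive) u∈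
                in comprehension⁺ (incomplete? D) (v , proj₁ (missing-refines uv)))
      , c , comprehension⁺ (incomplete? D) (_ , q-missing 0)
      , λ c∈ → let v , cv = comprehension⁻ (incomplete? transitive) c∈
                   cv′ , ¬K = missing-refines cv
               in ¬K (q∈K 0 , K-partner (q∈K 0) cv′))
    step : ∀ l → # (incomplete? D) ≤ l → ∃ λ f → f ≢ z × LargeOff z f
    step zero bound = contradiction (<-≤-trans fewer bound) λ ()
    step (suc l) bound
      with f , f≢z , large ← go l transitive (s≤s⁻¹ (≤-trans fewer bound))
        ( (λ ab ac → missing-unique (proj₁ (missing-refines ab)) (proj₁ (missing-refines ac)))
        , inj₁ (¬Kz ∘ proj₁ , zy)
        , λ v≢z v≢y → inj₁ (¬Kz ∘ proj₂ , toZ v≢z v≢y)) =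
      f , f≢z , pullback ¬Kz large

-- Reduction to a matching

#-singleton : (v : Fin n) → # (_≟ v) ≡ 1
#-singleton {n} v = trans (#-∑ (_≟ v)) (≤-antisym
  (∑-𝟙-≤1 (_≟ v) (λ { refl refl → refl }) (Unique.allFin⁺ n))
  (1≤∑-𝟙 (_≟ v) (∈-allFin v) refl))

module _ (D : OrientedGraph n) where
  open OrientedGraph D
  open Adjacency D

  N⁺⁺? : ∀ v → U.Decidable λ u → u ∉ ⁅ v ⁆ ∪ N⁺ D v × Nonempty (N⁻ D u ∩ N⁺ D v)
  N⁺⁺? v u = ¬? (u ∈? ⁅ v ⁆ ∪ N⁺ D v) ×-dec nonempty? (N⁻ D u ∩ N⁺ D v)

  #second≤∣N⁺⁺∣ : ∀ v → # (second? v) ≤ # (N⁺⁺? v)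
  #second≤∣N⁺⁺∣ v = #-mono (second? v) (N⁺⁺? v) λ {u} (u≢v , ¬vu , w , vw , wu) →
    (λ u∈ → [ u≢v ∘ x∈⁅y⁆⇒x≡y v , ¬vu ∘ comprehension⁻ (arc? v) ]′ (x∈p∪q⁻ ⁅ v ⁆ (N⁺ D v) u∈)) ,
    w , x∈p∩q⁺ (comprehension⁺ (λ w → arc? w u) wu , comprehension⁺ (arc? v) vw)

  sink-large : ∀ {z} → ¬ (∃ λ y → Arc z y) → HasLargeSecondNeighborhood D z
  sink-large {z} sink = #-mono (arc? z) (N⁺⁺? z) λ zy → contradiction (_ , zy) sink

module Apex (D : OrientedGraph n) {z y : Fin n} (zy : OrientedGraph.Arc D z y) where
  open OrientedGraph D
  open Adjacency D

  y≢z : y ≢ z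
  y≢z refl = noLoops zy

  Arc^ : Fin n → Fin n → Set
  Arc^ u v = (u ≢ z × v ≢ z × Arc u v) ⊎ (u ≡ z × v ≡ y) ⊎ (v ≡ z × u ≢ z × u ≢ y)

  apex : OrientedGraph n
  apex = record
    { Arc = Arc^
    ; arc? = λ u v → (¬? (u ≟ z) ×-dec ¬? (v ≟ z) ×-dec arc? u v)
                     ⊎-dec (u ≟ z ×-dec v ≟ y)
                     ⊎-dec (v ≟ z ×-dec ¬? (u ≟ z) ×-dec ¬? (u ≟ y))
    ; noLoops = λ where
        (inj₁ (_ , _ , uu)) → noLoops uu
        (inj₂ (inj₁ (refl , z≡y))) → y≢z (sym z≡y)
        (inj₂ (inj₂ (refl , z≢z , _))) → z≢z refl
    ; noDigons = λ where
        (inj₁ (_ , _ , uv)) (inj₁ (_ , _ , vu)) → noDigons uv vu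
        (inj₁ (_ , v≢z , _)) (inj₂ (inj₁ (v≡z , _))) → v≢z v≡z
        (inj₁ (u≢z , _)) (inj₂ (inj₂ (u≡z , _))) → u≢z u≡z
        (inj₂ (inj₁ (u≡z , _))) (inj₁ (_ , u≢z , _)) → u≢z u≡z
        (inj₂ (inj₁ (refl , refl))) (inj₂ (inj₁ (y≡z , _))) → y≢z y≡z
        (inj₂ (inj₁ (_ , v≡y))) (inj₂ (inj₂ (_ , _ , v≢y))) → v≢y v≡y
        (inj₂ (inj₂ (v≡z , _))) (inj₁ (v≢z , _)) → v≢z v≡z
        (inj₂ (inj₂ (_ , _ , u≢y))) (inj₂ (inj₁ (_ , u≡y))) → u≢y u≡y
        (inj₂ (inj₂ (_ , u≢z , _))) (inj₂ (inj₂ (u≡z , _))) → u≢z u≡z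
    }

  module D^ = OrientedGraph apex
  module A^ = Adjacency apex

  arc-z : Arc^ z y
  arc-z = inj₂ (inj₁ (refl , refl))

  arc-to-z : ∀ {v} → v ≢ z → v ≢ y → Arc^ v z
  arc-to-z v≢z v≢y = inj₂ (inj₂ (refl , v≢z , v≢y))

  missing-off : ∀ {a b} → A^.Missing a b → Missing a b × a ≢ z × b ≢ z
  missing-off {a} {b} miss@(a≢b , ¬ab , ¬ba) =
    (a≢b , (λ ab → ¬ab (inj₁ (a≢z , b≢z , ab))) , λ ba → ¬ba (inj₁ (b≢z , a≢z , ba))) , a≢z , b≢z
    where
    apart : ∀ {b} → ¬ A^.Missing z b
    apart {b} (z≢b , ¬zb , ¬bz) = ¬bz (arc-to-z (≢-sym z≢b) λ { refl → ¬zb arc-z })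
    a≢z : a ≢ z
    a≢z refl = apart miss
    b≢z : b ≢ z
    b≢z refl = apart (A^.missing-sym miss)

  module _ {f : Fin n} (f≢z : f ≢ z) where

    -- A path of `apex` through `z` has the form `f → z → y`; the hypothesis `via` either makes it a
    -- path of `D` or excludes it.
    second-off : ∀ {u} → (f ≢ y → Arc f z ⊎ u ≢ y) → u ≢ z × A^.Second f u → Second f u
    second-off {u} via (u≢z , u≢f , ¬fu , w , fw , wu) =
      u≢f , (λ fu → ¬fu (inj₁ (f≢z , u≢z , fu))) , path fw wu
      where
      path : Arc^ f w → Arc^ w u → ∃ λ w → Arc f w × Arc w u
      path (inj₁ (_ , _ , fw)) (inj₁ (_ , _ , wu)) = w , fw , wu
      path (inj₂ (inj₁ (f≡z , _))) _ = contradiction f≡z f≢z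
      path (inj₂ (inj₂ (w≡z , _))) (inj₁ (w≢z , _)) = contradiction w≡z w≢z
      path (inj₁ (_ , w≢z , _)) (inj₂ (inj₁ (w≡z , _))) = contradiction w≡z w≢z
      path (inj₂ (inj₂ (_ , _ , f≢y))) (inj₂ (inj₁ (refl , refl))) with via f≢y
      ... | inj₁ fz = z , fz , zy
      ... | inj₂ u≢y = contradiction refl u≢y
      path _ (inj₂ (inj₂ (u≡z , _))) = contradiction u≡z u≢z

    arc-kept : ∀ {u} → (Arc f z → f ≢ y) → Arc f u → Arc^ f u
    arc-kept {u} fz⇒f≢y fu with u ≟ z
    ... | yes refl = arc-to-z f≢z (fz⇒f≢y fu)
    ... | no u≢z = inj₁ (f≢z , u≢z , fu)

    fz⇒f≢y : Arc f z → f ≢ y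
    fz⇒f≢y fz refl = noDigons zy fz

    large-if-paid : (f ≢ y → Arc f z) → A^.LargeOff z f → # (arc? f) ≤ # (second? f)
    large-if-paid fz large = begin
      # (arc? f)              ≤⟨ #-mono (arc? f) (D^.arc? f) (arc-kept fz⇒f≢y) ⟩
      # (D^.arc? f)           ≤⟨ large ⟩
      # (A^.secondOff? z f)   ≤⟨ #-mono (A^.secondOff? z f) (second? f) (second-off (inj₁ ∘ fz)) ⟩
      # (second? f)           ∎
      where open ≤-Reasoning

    -- In `apex` the vertex `f` has the additional out-neighbor `z` and at most one additional
    -- second out-neighbor other than `z`, namely `y`; the two cancel.
    large-if-unpaid : f ≢ y → ¬ Arc f z → A^.LargeOff z f → # (arc? f) ≤ # (second? f)
    large-if-unpaid f≢y ¬fz large = +-cancelʳ-≤ 1 _ _ (begin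
      # (arc? f) + 1           ≡⟨ cong (# (arc? f) +_) (#-singleton z) ⟨
      # (arc? f) + # (_≟ z)    ≤⟨ #-pack (D^.arc? f) (arc? f) (_≟ z) (arc-kept fz⇒f≢y) (λ { refl → arc-to-z f≢z f≢y }) (λ { fz refl → ¬fz fz }) ⟩
      # (D^.arc? f)            ≤⟨ large ⟩
      # (A^.secondOff? z f)    ≤⟨ #-cover (A^.secondOff? z f) (second? f) (_≟ y) second ⟩
      # (second? f) + # (_≟ y) ≡⟨ cong (# (second? f) +_) (#-singleton y) ⟩
      # (second? f) + 1        ∎)
      where
      open ≤-Reasoning
      second : ∀ {u} → u ≢ z × A^.Second f u → Second f u ⊎ u ≡ y
      second {u} 2u with u ≟ y
      ... | yes u≡y = inj₂ u≡y
      ... | no u≢y = inj₁ (second-off (const (inj₂ u≢y)) 2u)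

    large-transfer : A^.LargeOff z f → # (arc? f) ≤ # (second? f)
    large-transfer large = transfer (f ≟ y) (arc? f z)
      where
      transfer : Dec (f ≡ y) → Dec (Arc f z) → # (arc? f) ≤ # (second? f)
      transfer (yes f≡y) _ = large-if-paid (contradiction f≡y) large
      transfer (no _) (yes fz) = large-if-paid (const fz) large
      transfer (no f≢y) (no ¬fz) = large-if-unpaid f≢y ¬fz large

  module _ {M S : Pred (Subset n) 0ℓ} (matching : IsMatching M) (z∈S : ∀ {e} → S e → z ∈ e)
    (missing⊆M∪S : ∀ {e} → MissingEdge D e → M e ⊎ S e) where

    missing-off-in-matching : ∀ {a b} → A^.Missing a b → M (⁅ a ⁆ ∪ ⁅ b ⁆)
    missing-off-in-matching {a} {b} ab
      with (a≢b , ¬ab , ¬ba) , a≢z , b≢z ← missing-off ab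
      with missing⊆M∪S (a , b , a≢b , refl , ¬ab , ¬ba)
    ... | inj₁ m = m
    ... | inj₂ s = contradiction (x∈p∪q⁻ ⁅ a ⁆ ⁅ b ⁆ (z∈S s))
      [ a≢z ∘ sym ∘ x∈⁅y⁆⇒x≡y a , b≢z ∘ sym ∘ x∈⁅y⁆⇒x≡y b ]′

    missing-off-unique : ∀ {a b c} → A^.Missing a b → A^.Missing a c → b ≡ c
    missing-off-unique {a} {b} {c} ab ac with b ≟ c
    ... | yes b≡c = b≡c
    ... | no b≢c = contradiction (a , x∈p∩q⁺ (a∈ b , a∈ c))
      (proj₂ matching (missing-off-in-matching ab) (missing-off-in-matching ac) distinct)
      where
      a∈ : ∀ x → a ∈ ⁅ a ⁆ ∪ ⁅ x ⁆
      a∈ x = x∈p∪q⁺ (inj₁ (x∈⁅x⁆ a))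
      distinct : ⁅ a ⁆ ∪ ⁅ b ⁆ ≢ ⁅ a ⁆ ∪ ⁅ c ⁆
      distinct eq = [ proj₁ ac ∘ sym ∘ x∈⁅y⁆⇒x≡y a , b≢c ∘ sym ∘ x∈⁅y⁆⇒x≡y b ]′
        (x∈p∪q⁻ ⁅ a ⁆ ⁅ b ⁆ (subst (c ∈_) (sym eq) (x∈p∪q⁺ (inj₂ (x∈⁅x⁆ c)))))

corollary4 : ∀ (n : ℕ) .{{_ : NonZero n}} (D : OrientedGraph n) (M S : Pred (Subset n) 0ℓ) →
    IsMatching M → IsStar S → MissingEdge D PartitionedInto M And S →
    ∃ λ v → HasLargeSecondNeighborhood D v
corollary4 n D M S matching (_ , z , z∈S) ((missing⊆M∪S , _) , _)
  with any? (OrientedGraph.arc? D z)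
... | no sink = z , sink-large D sink
... | yes (y , zy) =
  let f , f≢z , large = largeOff-matching (Apex.apex D zy)
        (Apex.missing-off-unique D zy matching z∈S missing⊆M∪S , Apex.arc-z D zy , Apex.arc-to-z D zy)
  in f , ≤-trans (Apex.large-transfer D zy f≢z large) (#second≤∣N⁺⁺∣ D f)
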